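{- Suppose that $\{0,1\}$ is characteristic for $T$, that reward addition is injective for $T$, and that $\mathtt{Rew}$ is numerable. Then, for every base type $b$, $\mathcal S$ is fully abstract with respect to $\approx_T$ at $b$; that is, for all programs $M,N:b$, if $M\approx_TN$ then $\mathcal S[\![M]\!]=\mathcal S[\![N]\!]$.
   Context: **Language.** Fix base types $b$, including $\mathtt{Bool}$ and $\mathtt{Rew}$; for each $b$ a set of constants $c:b$ (including $\mathtt{tt},\mathtt{ff}:\mathtt{Bool}$, $0:\mathtt{Rew}$); and function symbols $f:b_1\ldots b_m\to b$, including $=_b\,:b\,b\to\mathtt{Bool}$ for each $b$, $+:\mathtt{Rew}\,\mathtt{Rew}\to\mathtt{Rew}$, $\oplus_p:\mathtt{Rew}\,\mathtt{Rew}\to\mathtt{Rew}$ ($p\in[0,1]$) and $\le\,:\mathtt{Rew}\,\mathtt{Rew}\to\mathtt{Bool}$. Types: $\sigma::=b\mid\mathtt{Unit}\mid\sigma\times\sigma\mid\sigma\to\sigma$. Terms: $M::=x\mid c\mid f(M_1,\dots,M_m)\mid\mathtt{if}\,L\,\mathtt{then}\,M\,\mathtt{else}\,N\mid M\,\mathtt{or}\,N\mid N\cdot M\mid M+_pN\ (p\in[0,1])\mid *\mid\langle M,N\rangle\mid\mathtt{fst}(M)\mid\mathtt{snd}(M)\mid\lambda x{:}\sigma.M\mid MN$, up to $\alpha$-equivalence, with standard simple typing; $M\,\mathtt{or}\,N$ and $M+_pN$ have type $\sigma$ when $M,N:\sigma$, and $N\cdot M:\sigma$ when $N:\mathtt{Rew}$,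 $M:\sigma$. Programs are closed well-typed terms. Values (closed): $V::=c\mid *\mid\langle V,W\rangle\mid\lambda x{:}\sigma.M$; $\mathrm{Val}_\sigma$ is the set of values of type $\sigma$. Effect values: $E::=V\mid E_1\,\mathtt{or}\,E_2\mid c\cdot E\mid E_1+_pE_2$ ($c:\mathtt{Rew}$). **Ordinary operational semantics.** Evaluation contexts (closed): $\mathcal E::=[\,]\mid f(c_1,\dots,c_{k-1},\mathcal E,M_{k+1},\dots,M_m)\mid\mathtt{if}\,\mathcal E\,\mathtt{then}\,M\,\mathtt{else}\,N\mid\mathcal E\cdot M\mid\langle\mathcal E,N\rangle\mid\langle V,\mathcal E\rangle\mid\mathtt{fst}(\mathcal E)\mid\mathtt{snd}(\mathcal E)\mid\mathcal EN\mid(\lambda x{:}\sigma.M)\mathcal E$. Constants $\mathrm{val}_f(c_1,\dots,c_m):b$ are given for all $f$ and $c_i:b_i$, with $\mathrm{val}_{=_b}(c,c')=\mathtt{tt}$ if $c=c'$, else $\mathtt{ff}$. Steps $\mathcal E[Q]\to\mathcal E[Q']$ arise from: $f(c_1,\dots,c_m)\to\mathrm{val}_f(c_1,\dots,c_m)$; $\mathtt{if}\,\mathtt{tt}\,\mathtt{then}\,M\,\mathtt{else}\,N\to M$; $\mathtt{if}\,\mathtt{ff}\,\mathtt{then}\,M\,\mathtt{else}\,N\to N$; $\mathtt{fst}\langle V,W\rangle\to V$; $\mathtt{snd}\langle V,W\rangle\to W$; $(\lambda x{:}\sigma.M)V\to M[V/x]$. Evaluation is deterministic and terminating, and each program $M:\sigma$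 has an effect value $\mathrm{Op}(M):\sigma$ determined by $\mathrm{Op}(V)=V$; $\mathrm{Op}(M)=\mathrm{Op}(M')$ if $M\to M'$; $\mathrm{Op}(\mathcal E[M_1\,\mathtt{or}\,M_2])=\mathrm{Op}(\mathcal E[M_1])\,\mathtt{or}\,\mathrm{Op}(\mathcal E[M_2])$; $\mathrm{Op}(\mathcal E[M_1+_pM_2])=\mathrm{Op}(\mathcal E[M_1])+_p\mathrm{Op}(\mathcal E[M_2])$; $\mathrm{Op}(\mathcal E[c\cdot M_1])=c\cdot\mathrm{Op}(\mathcal E[M_1])$. **Rewards and interpretation.** A barycentric algebra is a set with binary operations $+_p$ ($p\in[0,1]$) such that $x+_1y=x$, $x+_px=x$, $x+_py=y+_{1-p}x$ and $(x+_py)+_qz=x+_{pq}(y+_{(1-p)q/(1-pq)}z)$ for $p,q<1$; finite convex combinations $\sum_ip_ix_i$ are then defined as usual. $R$ is a set with a barycentric algebra structure $+_p$, a commutative monoid structure $(+,0)$ with $r+(s+_ps')=(r+s)+_p(r+s')$, and a total order $\le$ such that for all $r,s,t$: $r\le s\iff r+t\le s+t$, and $r\le s\iff r+_pt\le s+_pt$ for $p\in(0,1)$. Given are nonempty sets $[\![b]\!]$ with $[\![\mathtt{Bool}]\!]=\{0,1\}$, $[\![\mathtt{Rew}]\!]=R$; elements $[\![c]\!]\in[\![b]\!]$ for $c:b$ with $[\![\mathtt{tt}]\!]=1$, $[\![\mathtt{ff}]\!]=0$, $[\![0]\!]=0$, distinct constants of the same type having distinct denotations, and $[\![c]\!]\ne0$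 for some $c:\mathtt{Rew}$; and functions $[\![f]\!]:[\![b_1]\!]\times\cdots\times[\![b_m]\!]\to[\![b]\!]$ with $[\![+]\!],[\![\oplus_p]\!],[\![\le]\!]$ the addition, the operation $+_p$ and the (characteristic function of the) order of $R$, and $[\![f]\!]([\![c_1]\!],\dots,[\![c_m]\!])=[\![\mathrm{val}_f(c_1,\dots,c_m)]\!]$. A barycentric $R$-module is a barycentric algebra with an action of $R$ ($0\cdot x=x$, $r\cdot(s\cdot x)=(r+s)\cdot x$) such that $r\cdot(x+_py)=r\cdot x+_pr\cdot y$; $R$ is one via $r\cdot s=r+s$. $DW(X)$ is the set of finitely supported probability distributions $\sum_ip_i\langle r_i,x_i\rangle$ on $R\times X$; it is the free barycentric $R$-module on $X$, with $r\cdot\sum_ip_i\langle r_i,x_i\rangle=\sum_ip_i\langle r+r_i,x_i\rangle$ and the usual $+_p$. The expected reward is $\mathbf E(\sum_ip_i\langle r_i,x_i\rangle)=\sum_ip_ir_i$. **Selection operational semantics.** Strategies: a value has the single strategy $*$; those of $E_1\,\mathtt{or}\,E_2$ are $1s$ ($s\in\mathrm{Str}(E_1)$) and $2s$ ($s\in\mathrm{Str}(E_2)$); those of $c\cdot E$ are those of $E$; those of $E_1+_pE_2$ are pairs $(s_1,s_2)$, $s_i\in\mathrm{Str}(E_i)$. Outcomes: $\mathrm{Out}(*,V)=\langle0,V\rangle$ (Dirac); $\mathrm{Out}(is,E_1\,\mathtt{or}\,E_2)=\mathrm{Out}(s,E_i)$; $\mathrm{Out}(s,c\cdot E)=[\![c]\!]\cdot\mathrm{Out}(s,E)$;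 $\mathrm{Out}((s_1,s_2),E_1+_pE_2)=p\,\mathrm{Out}(s_1,E_1)+(1-p)\,\mathrm{Out}(s_2,E_2)$. $\mathrm{Rew}(s,E)=\mathbf E(\mathrm{Out}(s,E))$. Strategies are totally ordered: on $E_1\,\mathtt{or}\,E_2$ all $1s$ precede all $2s'$, each group ordered as in $E_1$, resp. $E_2$; on $c\cdot E$ as in $E$; on $E_1+_pE_2$ lexicographically. $\mathrm{Op}_s(M)=\mathrm{Out}(s_{\rm opt},\mathrm{Op}(M))\in DW(\mathrm{Val}_\sigma)$, where $s_{\rm opt}$ is the least strategy of $\mathrm{Op}(M)$ maximizing $\mathrm{Rew}(s,\mathrm{Op}(M))$. **Auxiliary monad.** $T$ is a monad on sets (unit $\eta_T$, Kleisli extension $(-)^{\dagger_T}$), with operations $\cdot_T:R\times T(X)\to T(X)$ and $+_p:T(X)^2\to T(X)$ for all sets $X$ commuting with all Kleisli extensions (i.e. $T$-algebraic operations, induced by generic effects $R\to T(\{0\})$ and elements of $T(\{0,1\})$), and a $T$-algebra $\alpha_T:T(R)\to R$, such that (A1) each $T(X)$ is a barycentric $R$-module, and (A2) $\alpha_T(r\cdot u)=r+\alpha_T(u)$, $\alpha_T(u+_pv)=\alpha_T(u)+_p\alpha_T(v)$. **Denotational semantics.** $S(X)=(X\to R)\to T(X)$. For $F\in S(X)$, $\gamma:X\to R$ put $\mathbf R(F|\gamma)=\alpha_T(T(\gamma)(F(\gamma)))$. $S$ is a monad with $\eta(x)(\gamma)=\eta_T(x)$ and, for $f:X\to S(Y)$,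 $f^\dagger(F)(\gamma)=(\lambda x.\,f(x)(\gamma))^{\dagger_T}\big(F(\lambda x.\,\mathbf R(f(x)|\gamma))\big)$. Operations: $(G_0\,\mathtt{or}\,G_1)(\gamma)=G_0(\gamma)$ if $\mathbf R(G_0|\gamma)\ge\mathbf R(G_1|\gamma)$, else $G_1(\gamma)$; $(r\cdot G)(\gamma)=r\cdot_TG(\gamma)$; $(F+_pG)(\gamma)=F(\gamma)+_pG(\gamma)$. Types: $\mathcal S[\![b]\!]=[\![b]\!]$, $\mathcal S[\![\mathtt{Unit}]\!]=\{*\}$, $\mathcal S[\![\sigma\times\tau]\!]=\mathcal S[\![\sigma]\!]\times\mathcal S[\![\tau]\!]$, $\mathcal S[\![\sigma\to\tau]\!]=\mathcal S[\![\sigma]\!]\to S(\mathcal S[\![\tau]\!])$. A term $\Gamma\vdash M:\sigma$ denotes $\mathcal S[\![M]\!]:\mathcal S[\![\Gamma]\!]\to S(\mathcal S[\![\sigma]\!])$ by the standard left-to-right call-by-value monadic semantics: variables, constants, $*$ and abstractions via $\eta$ ($\mathcal S[\![\lambda x{:}\sigma.M]\!](\rho)=\eta(a\mapsto\mathcal S[\![M]\!](\rho,a))$); pairs, projections, applications, function symbols and conditions of conditionals by sequencing arguments left to right with Kleisli extension; $\mathtt{or}$ and $+_p$ by applying the corresponding operation of $S$ to the denotations of the arguments; $\mathcal S[\![N\cdot M]\!](\rho)=(r\mapsto r\cdot\mathcal S[\![M]\!](\rho))^\dagger(\mathcal S[\![N]\!](\rho))$. **Observational equivalence.** $\theta_X:DW(X)\to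 T(X)$ is $\theta_X(\sum_ip_i\langle r_i,x_i\rangle)=\sum_ip_i(r_i\cdot_T\eta_T(x_i))$. For programs $M:\mathtt{Bool}$ put $\mathrm{Ob}_T(M)=\theta(\mathrm{Op}_s(M))\in T(\mathrm{Val}_{\mathtt{Bool}})$. For programs $M,N:\sigma$, $M\approx_TN$ iff $\mathrm{Ob}_T(C[M])=\mathrm{Ob}_T(C[N])$ for every one-hole context $C[\;]$ such that $C[L]:\mathtt{Bool}$ is a program for every program $L:\sigma$. **Hypotheses.** $\{0,1\}$ is characteristic for $T$ if for any set $X$ and distinct $u,v\in T(X)$ there is $f:X\to\{0,1\}$ with $T(f)(u)\ne T(f)(v)$. Reward addition is injective for $T$ if for every set $X$ and $\gamma:X\to R$ the map $k_\gamma=f^{\dagger_T}:T(X)\to T(X)$, where $f(x)=\gamma(x)\cdot_T\eta_T(x)$, is injective. $\mathtt{Rew}$ is numerable if every element of $R=[\![\mathtt{Rew}]\!]$ is $[\![c]\!]$ for some constant $c:\mathtt{Rew}$. -}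

module Defs where

open import Algebra.Bundles using (CommutativeRing)
import Algebra.Properties.Ring as RingProperties
open import Algebra.Structures using (IsCommutativeRing; IsCommutativeMonoid)
open import Axiom.ExcludedMiddle using (ExcludedMiddle)
open import Data.Bool.Base using (Bool; true; false; if_then_else_)
open import Data.Empty using (⊥)
open import Data.Empty.Irrelevant using (⊥-elim)
open import Data.List.Base using (List; []; _∷_)
open import Data.List.Relation.Unary.All as All using (All; []; _∷_)
open import Data.Nat.Base as ℕ using (ℕ)
open import Data.Product.Base
  using (Σ; ∃; ∃-syntax; _×_; _,_; proj₁; proj₂; map₁; map₂)
open import Data.Product.Relation.Binary.Lex.Strict using (×-Lex)
open import Data.Sum.Base using (_⊎_; inj₁; inj₂)
open import Data.Sum.Relation.Binary.LeftOrder using (_⊎-<_; ₁∼₁; ₁∼₂; ₂∼₂)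
open import Data.Unit.Base using (⊤; tt)
open import Data.Vec.Base as Vec using (Vec; []; _∷_)
open import Data.Vec.Relation.Unary.All as VAll using ([]; _∷_)
import Data.Vec.Relation.Unary.All.Properties as VAll
open import Function.Base using (_∘_; id)
open import Function.Bundles using (_⇔_)
open import Function.Definitions using (Injective)
open import Level using (0ℓ)
open import Relation.Binary.Core using (Rel)
open import Relation.Binary.Structures using (IsTotalOrder)
open import Relation.Binary.PropositionalEquality
  using (_≡_; _≢_; refl; sym; trans; cong; cong₂; subst; module ≡-Reasoning)
import Relation.Binary.Construct.NonStrictToStrict as Strict
open import Relation.Nullary using (yes; no; ⌊_⌋; contradiction)

-- The real numbers, axiomatised up to isomorphism as a complete ordered field.
-- The value of 0# ⁻¹ is left unspecified.

record CompleteOrderedField : Set₁ where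
  infixl 6 _+_
  infixl 7 _*_
  infix 8 -_
  infix 9 _⁻¹
  infix 4 _≤_
  field
    Carrier           : Set
    _+_ _*_           : Carrier → Carrier → Carrier
    -_ _⁻¹            : Carrier → Carrier
    0# 1#             : Carrier
    _≤_               : Rel Carrier 0ℓ
    isCommutativeRing : IsCommutativeRing _≡_ _+_ _*_ -_ 0# 1#
    0≢1               : 0# ≢ 1#
    inverse           : ∀ x → x ≢ 0# → x * x ⁻¹ ≡ 1#
    isTotalOrder      : IsTotalOrder _≡_ _≤_
    +-mono-≤          : ∀ {x y} z → x ≤ y → x + z ≤ y + z
    *-nonneg          : ∀ {x y} → 0# ≤ x → 0# ≤ y → 0# ≤ x * y

  IsUpperBound : Carrier → (Carrier → Set) → Set
  IsUpperBound u P = ∀ x → P x → x ≤ u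

  field
    supremum : (P : Carrier → Set) → ∃ P → (∃[ u ] IsUpperBound u P) →
               ∃[ s ] (IsUpperBound s P × (∀ u → IsUpperBound u P → s ≤ u))

module RealLemmas (ℝ : CompleteOrderedField) where
  open CompleteOrderedField ℝ
  open IsCommutativeRing isCommutativeRing public
    using (+-assoc; +-comm; +-identityˡ; +-identityʳ; *-assoc; *-comm;
           *-identityˡ; *-identityʳ; distribˡ; distribʳ; zeroˡ; zeroʳ;
           -‿inverseˡ; -‿inverseʳ)
  open IsTotalOrder isTotalOrder public
    using (total) renaming (trans to ≤-trans; antisym to ≤-antisym; refl to ≤-refl)

  commutativeRing : CommutativeRing 0ℓ 0ℓ
  commutativeRing = record { isCommutativeRing = isCommutativeRing }

  open RingProperties (CommutativeRing.ring commutativeRing)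
    using (-‿distribˡ-*; -‿distribʳ-*; -‿involutive)

  open ≡-Reasoning

  infixl 6 _-_
  _-_ : Carrier → Carrier → Carrier
  x - y = x + - y

  x-y+y : ∀ x y → (x - y) + y ≡ x
  x-y+y x y = begin
    (x + - y) + y ≡⟨ +-assoc x (- y) y ⟩
    x + (- y + y) ≡⟨ cong (x +_) (-‿inverseˡ y) ⟩
    x + 0#        ≡⟨ +-identityʳ x ⟩
    x             ∎

  x+y-x : ∀ x y → (x + y) - x ≡ y
  x+y-x x y = begin
    (x + y) + - x ≡⟨ cong (_+ - x) (+-comm x y) ⟩
    (y + x) + - x ≡⟨ +-assoc y x (- x) ⟩
    y + (x + - x) ≡⟨ cong (y +_) (-‿inverseʳ x) ⟩
    y + 0#        ≡⟨ +-identityʳ y ⟩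
    y             ∎

  ≤⇒0≤- : ∀ {x y} → x ≤ y → 0# ≤ y - x
  ≤⇒0≤- {x} {y} x≤y = subst (_≤ y - x) (-‿inverseʳ x) (+-mono-≤ (- x) x≤y)

  0≤-⇒≤ : ∀ {x y} → 0# ≤ y - x → x ≤ y
  0≤-⇒≤ {x} {y} h = subst (_≤ y) (+-identityˡ x) (subst (0# + x ≤_) (x-y+y y x) (+-mono-≤ x h))

  0≤1 : 0# ≤ 1#
  0≤1 with total 0# 1#
  ... | inj₁ h = h
  ... | inj₂ h = subst (0# ≤_) eq (*-nonneg 0≤-1 0≤-1)
    where
    0≤-1 : 0# ≤ - 1#
    0≤-1 = subst (0# ≤_) (+-identityˡ (- 1#)) (≤⇒0≤- h)
    eq : - 1# * - 1# ≡ 1#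
    eq = begin
      - 1# * - 1#   ≡⟨ sym (-‿distribˡ-* 1# (- 1#)) ⟩
      - (1# * - 1#) ≡⟨ cong -_ (*-identityˡ (- 1#)) ⟩
      - - 1#        ≡⟨ -‿involutive 1# ⟩
      1#            ∎

  +-nonneg : ∀ {x y} → 0# ≤ x → 0# ≤ y → 0# ≤ x + y
  +-nonneg {x} {y} 0≤x 0≤y =
    ≤-trans 0≤y (subst (_≤ x + y) (+-identityˡ y) (+-mono-≤ y 0≤x))

  x≤x+y : ∀ x {y} → 0# ≤ y → x ≤ x + y
  x≤x+y x {y} 0≤y = 0≤-⇒≤ (subst (0# ≤_) (sym (x+y-x x y)) 0≤y)

  ⁻¹-nonneg : ∀ {x} → 0# ≤ x → x ≢ 0# → 0# ≤ x ⁻¹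
  ⁻¹-nonneg {x} 0≤x x≢0 with total 0# (x ⁻¹)
  ... | inj₁ h = h
  ... | inj₂ h = ⊥-elim (0≢1 (≤-antisym 0≤1 (0≤-⇒≤ (subst (0# ≤_) eq (*-nonneg 0≤x (≤⇒0≤- h))))))
    where
    eq : x * (0# - x ⁻¹) ≡ 0# - 1#
    eq = begin
      x * (0# - x ⁻¹) ≡⟨ cong (x *_) (+-identityˡ (- (x ⁻¹))) ⟩
      x * - (x ⁻¹)    ≡⟨ sym (-‿distribʳ-* x (x ⁻¹)) ⟩
      - (x * x ⁻¹)    ≡⟨ cong -_ (inverse x x≢0) ⟩
      - 1#            ≡⟨ sym (+-identityˡ (- 1#)) ⟩
      0# - 1#         ∎

  1-x≡0⇒x≡1 : ∀ {x} → 1# - x ≡ 0# → x ≡ 1#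
  1-x≡0⇒x≡1 {x} h = begin
    x            ≡⟨ sym (+-identityˡ x) ⟩
    0# + x       ≡⟨ cong (_+ x) (sym h) ⟩
    (1# - x) + x ≡⟨ x-y+y 1# x ⟩
    1#           ∎

  1-[1-x] : ∀ x → 1# - (1# - x) ≡ x
  1-[1-x] x = trans (cong (_- (1# - x)) (sym (x-y+y 1# x))) (x+y-x (1# - x) x)

  x+[1-x] : ∀ x → x + (1# - x) ≡ 1#
  x+[1-x] x = trans (+-comm x (1# - x)) (x-y+y 1# x)

module Convexity (ℝ : CompleteOrderedField) where
  open CompleteOrderedField ℝ
  open RealLemmas ℝ
  open RingProperties (CommutativeRing.ring commutativeRing) using (-‿distribʳ-*)

  -- The unit interval [0,1].  The bounds are irrelevant, so that two elements
  -- with the same value are equal.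

  record I : Set where
    constructor mk
    field
      value  : Carrier
      .lower : 0# ≤ value
      .upper : value ≤ 1#
  open I public using (value)

  _<1 : I → Set
  p <1 = Strict._<_ _≡_ _≤_ (value p) 1#

  0<_ : I → Set
  0< p = Strict._<_ _≡_ _≤_ 0# (value p)

  1ᴵ : I
  1ᴵ = mk 1# 0≤1 ≤-refl

  1-_ : I → I
  1- mk p 0≤p p≤1 =
    mk (1# - p) (≤⇒0≤- p≤1) (0≤-⇒≤ (subst (0# ≤_) (sym (1-[1-x] p)) 0≤p))

  *-≤1 : ∀ {x y} → 0# ≤ x → x ≤ 1# → y ≤ 1# → x * y ≤ 1#
  *-≤1 {x} {y} 0≤x x≤1 y≤1 = ≤-trans (0≤-⇒≤ (subst (0# ≤_) eq (*-nonneg 0≤x (≤⇒0≤- y≤1)))) x≤1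
    where
    open ≡-Reasoning
    eq : x * (1# - y) ≡ x - x * y
    eq = begin
      x * (1# + - y)     ≡⟨ distribˡ x 1# (- y) ⟩
      x * 1# + x * - y   ≡⟨ cong₂ _+_ (*-identityʳ x) (sym (-‿distribʳ-* x y)) ⟩
      x + - (x * y)      ∎

  infixl 7 _*ᴵ_
  _*ᴵ_ : I → I → I
  mk p 0≤p p≤1 *ᴵ mk q 0≤q q≤1 = mk (p * q) (*-nonneg 0≤p 0≤q) (*-≤1 0≤p p≤1 q≤1)

  -- In assoc, the equation for s says s = (1-p)q / (1-pq); the divisor is
  -- nonzero because p , q < 1.

  record IsBarycentricAlgebra {X : Set} (_+[_]_ : X → I → X → X) : Set where
    field
      unit  : ∀ x y → (x +[ 1ᴵ ] y) ≡ x
      idem  : ∀ p x → (x +[ p ] x) ≡ x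
      skew  : ∀ p x y → (x +[ p ] y) ≡ (y +[ 1- p ] x)
      assoc : ∀ p q s → p <1 → q <1 →
              value s * (1# - value p * value q) ≡ (1# - value p) * value q →
              ∀ x y z → ((x +[ p ] y) +[ q ] z) ≡ (x +[ p *ᴵ q ] (y +[ s ] z))

  -- Finitely supported probability distributions, presented as formal convex
  -- combinations ∑ pᵢ xᵢ.  A distribution has many presentations (points may
  -- be repeated, weights may be zero); in a barycentric algebra the value of
  -- a convex combination depends only on the distribution presented.

  private
    variable
      A B : Set
      m n : ℕ

  totalWeight : Vec (Carrier × A) n → Carrier
  totalWeight []            = 0#
  totalWeight ((p , _) ∷ v) = p + totalWeight v

  Nonneg : Vec (Carrier × A) n → Set
  Nonneg = VAll.All λ t → 0# ≤ proj₁ t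

  record IsDistribution {A : Set} {n} (v : Vec (Carrier × A) n) : Set where
    constructor isDist
    field
      nonneg : Nonneg v
      total1 : totalWeight v ≡ 1#

  record Dist (A : Set) : Set where
    constructor dist
    field
      {size}          : ℕ
      terms           : Vec (Carrier × A) size
      .isDistribution : IsDistribution terms

  scale : ∀ {A : Set} {n} → Carrier → Vec (Carrier × A) n → Vec (Carrier × A) n
  scale c = Vec.map (map₁ (c *_))

  totalWeight-scale : ∀ c (v : Vec (Carrier × A) n) → totalWeight (scale c v) ≡ c * totalWeight v
  totalWeight-scale c []            = sym (zeroʳ c)
  totalWeight-scale c ((p , _) ∷ v) =
    trans (cong (c * p +_) (totalWeight-scale c v)) (sym (distribˡ c p (totalWeight v)))

  totalWeight-++ : (v : Vec (Carrier × A) m) (w : Vec (Carrier × A) n) →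
                   totalWeight (v Vec.++ w) ≡ totalWeight v + totalWeight w
  totalWeight-++ []            w = sym (+-identityˡ (totalWeight w))
  totalWeight-++ ((p , _) ∷ v) w =
    trans (cong (p +_) (totalWeight-++ v w)) (sym (+-assoc p (totalWeight v) (totalWeight w)))

  totalWeight-map₂ : (f : A → B) (v : Vec (Carrier × A) n) →
                     totalWeight (Vec.map (map₂ f) v) ≡ totalWeight v
  totalWeight-map₂ f []            = refl
  totalWeight-map₂ f ((p , _) ∷ v) = cong (p +_) (totalWeight-map₂ f v)

  scale-nonneg : ∀ {c} {v : Vec (Carrier × A) n} → 0# ≤ c → Nonneg v → Nonneg (scale c v)
  scale-nonneg 0≤c []         = []
  scale-nonneg 0≤c (0≤p ∷ ps) = *-nonneg 0≤c 0≤p ∷ scale-nonneg 0≤c ps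

  map₂-nonneg : (f : A → B) {v : Vec (Carrier × A) n} → Nonneg v → Nonneg (Vec.map (map₂ f) v)
  map₂-nonneg f []         = []
  map₂-nonneg f (0≤p ∷ ps) = 0≤p ∷ map₂-nonneg f ps

  totalWeight-nonneg : {v : Vec (Carrier × A) n} → Nonneg v → 0# ≤ totalWeight v
  totalWeight-nonneg []         = ≤-refl
  totalWeight-nonneg (0≤p ∷ ps) = +-nonneg 0≤p (totalWeight-nonneg ps)

  normalise : Carrier → Vec (Carrier × A) n → Vec (Carrier × A) n
  normalise p = scale ((1# - p) ⁻¹)

  isDistribution-map₂ : (f : A → B) {v : Vec (Carrier × A) n} →
                        IsDistribution v → IsDistribution (Vec.map (map₂ f) v)
  isDistribution-map₂ f {v} (isDist nn t1) =
    isDist (map₂-nonneg f nn) (trans (totalWeight-map₂ f v) t1)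

  isDistribution-mix : ∀ {p q} {v : Vec (Carrier × A) m} {w : Vec (Carrier × A) n} →
                       0# ≤ p → 0# ≤ q → p + q ≡ 1# → IsDistribution v → IsDistribution w →
                       IsDistribution (scale p v Vec.++ scale q w)
  isDistribution-mix {p = p} {q} {v} {w} 0≤p 0≤q p+q≡1 (isDist nv tv) (isDist nw tw) =
    isDist (VAll.++⁺ (scale-nonneg 0≤p nv) (scale-nonneg 0≤q nw)) (begin
      totalWeight (scale p v Vec.++ scale q w)       ≡⟨ totalWeight-++ (scale p v) (scale q w) ⟩
      totalWeight (scale p v) + totalWeight (scale q w)
        ≡⟨ cong₂ _+_ (totalWeight-scale p v) (totalWeight-scale q w) ⟩
      p * totalWeight v + q * totalWeight w
        ≡⟨ cong₂ (λ a b → p * a + q * b) tv tw ⟩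
      p * 1# + q * 1#                                ≡⟨ cong₂ _+_ (*-identityʳ p) (*-identityʳ q) ⟩
      p + q                                          ≡⟨ p+q≡1 ⟩
      1#                                             ∎)
    where open ≡-Reasoning

  module _ {p : Carrier} {x : A} {v : Vec (Carrier × A) n} where

    head-nonneg : IsDistribution ((p , x) ∷ v) → 0# ≤ p
    head-nonneg (isDist (0≤p ∷ _) _) = 0≤p

    head-≤1 : IsDistribution ((p , x) ∷ v) → p ≤ 1#
    head-≤1 (isDist (_ ∷ nn) t1) = subst (p ≤_) t1 (x≤x+y p (totalWeight-nonneg nn))

    isDistribution-normalise : p ≢ 1# → IsDistribution ((p , x) ∷ v) →
                               IsDistribution (normalise p v)
    isDistribution-normalise p≢1 d@(isDist (_ ∷ nn) t1) =
      isDist (scale-nonneg (⁻¹-nonneg (≤⇒0≤- (head-≤1 d)) 1-p≢0) nn) (begin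
        totalWeight (normalise p v)     ≡⟨ totalWeight-scale ((1# - p) ⁻¹) v ⟩
        (1# - p) ⁻¹ * totalWeight v     ≡⟨ cong ((1# - p) ⁻¹ *_) tail≡ ⟩
        (1# - p) ⁻¹ * (1# - p)          ≡⟨ *-comm ((1# - p) ⁻¹) (1# - p) ⟩
        (1# - p) * (1# - p) ⁻¹          ≡⟨ inverse (1# - p) 1-p≢0 ⟩
        1#                              ∎)
      where
      open ≡-Reasoning
      1-p≢0 : 1# - p ≢ 0#
      1-p≢0 = p≢1 ∘ 1-x≡0⇒x≡1
      tail≡ : totalWeight v ≡ 1# - p
      tail≡ = trans (sym (x+y-x p (totalWeight v))) (cong (_- p) t1)

  dirac : A → Dist A
  dirac x = dist ((1# , x) ∷ []) (isDist (0≤1 ∷ []) (+-identityʳ 1#))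

  mapDist : (A → B) → Dist A → Dist B
  mapDist f (dist v d) = dist (Vec.map (map₂ f) v) (isDistribution-map₂ f d)

  mixDist : I → Dist A → Dist A → Dist A
  mixDist (mk p 0≤p p≤1) (dist v d) (dist w e) =
    dist (scale p v Vec.++ scale (1# - p) w)
         (isDistribution-mix 0≤p (≤⇒0≤- p≤1) (x+[1-x] p) d e)

  module _ (em : ExcludedMiddle 0ℓ) {X : Set} (_+[_]_ : X → I → X → X) where

    -- ∑ᵢ pᵢ xᵢ  is  x₁  if p₁ = 1, and  x₁ +_{p₁} ∑_{i≥2} (pᵢ / (1-p₁)) xᵢ  otherwise.
    convexVec : (v : Vec (Carrier × X) n) → .(IsDistribution v) → X
    convexVec []            d = ⊥-elim (0≢1 (IsDistribution.total1 d))
    convexVec ((p , x) ∷ v) d with em {p ≡ 1#}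
    ... | yes _  = x
    ... | no p≢1 = x +[ mk p (head-nonneg d) (head-≤1 d) ]
                     convexVec (normalise p v) (isDistribution-normalise p≢1 d)

    convex : Dist X → X
    convex (dist v d) = convexVec v d

data BaseType (Other : Set) : Set where
  bool rew : BaseType Other
  other    : Other → BaseType Other

baseSet : {O : Set} → Set → (O → Set) → BaseType O → Set
baseSet R ⟦_⟧ bool      = Bool
baseSet R ⟦_⟧ rew       = R
baseSet R ⟦_⟧ (other o) = ⟦ o ⟧

module Structures (ℝ : CompleteOrderedField) where
  open Convexity ℝ

  record RewardAlgebra : Set₁ where
    infixl 6 _+_
    infix 4 _≤_
    field
      R                     : Set
      _+[_]_                : R → I → R → R
      isBarycentricAlgebra  : IsBarycentricAlgebra _+[_]_
      _+_                   : R → R → R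
      0#                    : R
      isCommutativeMonoid   : IsCommutativeMonoid _≡_ _+_ 0#
      +-distribˡ-mix        : ∀ p r s s′ → r + (s +[ p ] s′) ≡ ((r + s) +[ p ] (r + s′))
      _≤_                   : Rel R 0ℓ
      isTotalOrder          : IsTotalOrder _≡_ _≤_
      +-≤                   : ∀ r s t → r ≤ s ⇔ r + t ≤ s + t
      mix-≤                 : ∀ p → 0< p → p <1 → ∀ r s t → r ≤ s ⇔ (r +[ p ] t) ≤ (s +[ p ] t)

  data FunctionSymbol {O : Set} (Other : List (BaseType O) → BaseType O → Set) :
                      List (BaseType O) → BaseType O → Set where
    eq    : ∀ b → FunctionSymbol Other (b ∷ b ∷ []) bool
    plus  : FunctionSymbol Other (rew ∷ rew ∷ []) rew
    mix   : I → FunctionSymbol Other (rew ∷ rew ∷ []) rew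
    leq   : FunctionSymbol Other (rew ∷ rew ∷ []) bool
    other : ∀ {bs b} → Other bs b → FunctionSymbol Other bs b

  record Signature : Set₁ where
    field
      OtherBase : Set
    Base : Set
    Base = BaseType OtherBase
    field
      Con         : Base → Set
      ttᶜ ffᶜ     : Con bool
      0ᶜ          : Con rew
      OtherSymbol : List Base → Base → Set
    Fun : List Base → Base → Set
    Fun = FunctionSymbol OtherSymbol
    field
      val      : ∀ {bs b} → Fun bs b → All Con bs → Con b
      val-eq-≡ : ∀ {b} (c : Con b) → val (eq b) (c ∷ c ∷ []) ≡ ttᶜ
      val-eq-≢ : ∀ {b} (c c′ : Con b) → c ≢ c′ → val (eq b) (c ∷ c′ ∷ []) ≡ ffᶜ

  record Interpretation (𝓡 : RewardAlgebra) (Sg : Signature) : Set₁ where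
    open RewardAlgebra 𝓡
    open Signature Sg
    field
      ⟦_⟧other : OtherBase → Set
      nonempty : ∀ o → ⟦ o ⟧other

    ⟦_⟧base : Base → Set
    ⟦_⟧base = baseSet R ⟦_⟧other

    field
      ⟦_⟧con        : ∀ {b} → Con b → ⟦ b ⟧base
      ⟦tt⟧          : ⟦ ttᶜ ⟧con ≡ true
      ⟦ff⟧          : ⟦ ffᶜ ⟧con ≡ false
      ⟦0⟧           : ⟦ 0ᶜ ⟧con ≡ 0#
      con-injective : ∀ {b} → Injective _≡_ _≡_ (⟦_⟧con {b})
      nonzero       : ∃[ c ] ⟦_⟧con {rew} c ≢ 0#
      ⟦_⟧fun        : ∀ {bs b} → Fun bs b → All ⟦_⟧base bs → ⟦ b ⟧base
      ⟦plus⟧        : ∀ r s → ⟦ plus ⟧fun (r ∷ s ∷ []) ≡ r + s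
      ⟦mix⟧         : ∀ p r s → ⟦ mix p ⟧fun (r ∷ s ∷ []) ≡ (r +[ p ] s)
      ⟦leq⟧         : ∀ r s → ⟦ leq ⟧fun (r ∷ s ∷ []) ≡ true ⇔ r ≤ s
      ⟦val⟧         : ∀ {bs b} (f : Fun bs b) (cs : All Con bs) →
                      ⟦ f ⟧fun (All.map ⟦_⟧con cs) ≡ ⟦ val f cs ⟧con

  record IsBarycentricModule (𝓡 : RewardAlgebra) {X : Set}
                             (_+[_]_ : X → I → X → X)
                             (_·_ : RewardAlgebra.R 𝓡 → X → X) : Set where
    private module R = RewardAlgebra 𝓡
    field
      isBarycentricAlgebra : IsBarycentricAlgebra _+[_]_
      ·-identity           : ∀ x → R.0# · x ≡ x
      ·-assoc              : ∀ r s x → r · (s · x) ≡ (r R.+ s) · x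
      ·-distribˡ-mix       : ∀ p r x y → r · (x +[ p ] y) ≡ ((r · x) +[ p ] (r · y))

  record AuxiliaryMonad (𝓡 : RewardAlgebra) : Set₁ where
    private module R = RewardAlgebra 𝓡
    open R using (R)
    infix 10 _†
    infixr 7 _·_
    field
      T  : Set → Set
      η  : ∀ {X} → X → T X
      _† : ∀ {X Y} → (X → T Y) → T X → T Y

      †-identityˡ : ∀ {X Y} (f : X → T Y) x → (f †) (η x) ≡ f x
      †-identityʳ : ∀ {X} (u : T X) → (η †) u ≡ u
      †-assoc     : ∀ {X Y Z} (g : Y → T Z) (f : X → T Y) u →
                    (g †) ((f †) u) ≡ ((λ x → (g †) (f x)) †) u

    map : ∀ {X Y} → (X → Y) → T X → T Y
    map f = (η ∘ f) †

    join : ∀ {X} → T (T X) → T X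
    join = id †

    field
      _·_    : ∀ {X} → R → T X → T X
      _+[_]_ : ∀ {X} → T X → I → T X → T X
      ·-algebraic   : ∀ {X Y} (f : X → T Y) r u → (f †) (r · u) ≡ r · (f †) u
      mix-algebraic : ∀ {X Y} (f : X → T Y) p u v →
                      (f †) (u +[ p ] v) ≡ ((f †) u +[ p ] (f †) v)

      α      : T R → R
      α-η    : ∀ r → α (η r) ≡ r
      α-join : ∀ (w : T (T R)) → α (map α w) ≡ α (join w)

      isBarycentricModule : ∀ {X} → IsBarycentricModule 𝓡 {T X} _+[_]_ _·_
      α-·   : ∀ r u → α (r · u) ≡ r R.+ α u
      α-mix : ∀ p u v → α (u +[ p ] v) ≡ (α u R.+[ p ] α v)

infixr 6 _⊗_
infixr 5 _⇒_

data Type (Base : Set) : Set where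
  base    : Base → Type Base
  unit    : Type Base
  _⊗_ _⇒_ : Type Base → Type Base → Type Base

-- Intrinsically typed de Bruijn terms; α-equivalent terms are identical.

module Syntax (ℝ : CompleteOrderedField) (Sg : Structures.Signature ℝ) where
  open Convexity ℝ using (I)
  open Structures ℝ
  open Signature Sg

  Ty Cx : Set
  Ty = Type Base
  Cx = List Ty

  private
    variable
      Γ Δ Θ   : Cx
      σ τ υ   : Ty
      b       : Base
      bs ds   : List Base

  infix 4 _∋_
  data _∋_ : Cx → Ty → Set where
    Z : σ ∷ Γ ∋ σ
    S : Γ ∋ σ → τ ∷ Γ ∋ σ

  infixr 5 _or_
  infixr 7 _·_
  data Term (Γ : Cx) : Ty → Set where
    var    : Γ ∋ σ → Term Γ σ
    con    : Con b → Term Γ (base b)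
    fun    : Fun bs b → All (λ b → Term Γ (base b)) bs → Term Γ (base b)
    if     : Term Γ (base bool) → Term Γ σ → Term Γ σ → Term Γ σ
    _or_   : Term Γ σ → Term Γ σ → Term Γ σ
    _·_    : Term Γ (base rew) → Term Γ σ → Term Γ σ
    _+[_]_ : Term Γ σ → I → Term Γ σ → Term Γ σ
    ∗      : Term Γ unit
    ⟨_,_⟩  : Term Γ σ → Term Γ τ → Term Γ (σ ⊗ τ)
    fst    : Term Γ (σ ⊗ τ) → Term Γ σ
    snd    : Term Γ (σ ⊗ τ) → Term Γ τ
    ƛ      : Term (σ ∷ Γ) τ → Term Γ (σ ⇒ τ)
    app    : Term Γ (σ ⇒ τ) → Term Γ σ → Term Γ τ

  Args : Cx → List Base → Set
  Args Γ = All (λ b → Term Γ (base b))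

  Program : Ty → Set
  Program = Term []

  Ren Sub : Cx → Cx → Set
  Ren Γ Δ = ∀ {σ} → Γ ∋ σ → Δ ∋ σ
  Sub Γ Δ = ∀ {σ} → Γ ∋ σ → Term Δ σ

  ext : Ren Γ Δ → Ren (σ ∷ Γ) (σ ∷ Δ)
  ext ρ Z     = Z
  ext ρ (S x) = S (ρ x)

  rename     : Ren Γ Δ → Term Γ σ → Term Δ σ
  renameArgs : Ren Γ Δ → Args Γ bs → Args Δ bs

  rename ρ (var x)      = var (ρ x)
  rename ρ (con c)      = con c
  rename ρ (fun f Ms)   = fun f (renameArgs ρ Ms)
  rename ρ (if L M N)   = if (rename ρ L) (rename ρ M) (rename ρ N)
  rename ρ (M or N)     = rename ρ M or rename ρ N
  rename ρ (N · M)      = rename ρ N · rename ρ M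
  rename ρ (M +[ p ] N) = rename ρ M +[ p ] rename ρ N
  rename ρ ∗            = ∗
  rename ρ ⟨ M , N ⟩    = ⟨ rename ρ M , rename ρ N ⟩
  rename ρ (fst M)      = fst (rename ρ M)
  rename ρ (snd M)      = snd (rename ρ M)
  rename ρ (ƛ M)        = ƛ (rename (ext ρ) M)
  rename ρ (app M N)    = app (rename ρ M) (rename ρ N)

  renameArgs ρ []       = []
  renameArgs ρ (M ∷ Ms) = rename ρ M ∷ renameArgs ρ Ms

  exts : Sub Γ Δ → Sub (σ ∷ Γ) (σ ∷ Δ)
  exts θ Z     = var Z
  exts θ (S x) = rename S (θ x)

  substitute     : Sub Γ Δ → Term Γ σ → Term Δ σ
  substituteArgs : Sub Γ Δ → Args Γ bs → Args Δ bs

  substitute θ (var x)      = θ x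
  substitute θ (con c)      = con c
  substitute θ (fun f Ms)   = fun f (substituteArgs θ Ms)
  substitute θ (if L M N)   = if (substitute θ L) (substitute θ M) (substitute θ N)
  substitute θ (M or N)     = substitute θ M or substitute θ N
  substitute θ (N · M)      = substitute θ N · substitute θ M
  substitute θ (M +[ p ] N) = substitute θ M +[ p ] substitute θ N
  substitute θ ∗            = ∗
  substitute θ ⟨ M , N ⟩    = ⟨ substitute θ M , substitute θ N ⟩
  substitute θ (fst M)      = fst (substitute θ M)
  substitute θ (snd M)      = snd (substitute θ M)
  substitute θ (ƛ M)        = ƛ (substitute (exts θ) M)
  substitute θ (app M N)    = app (substitute θ M) (substitute θ N)

  substituteArgs θ []       = []
  substituteArgs θ (M ∷ Ms) = substitute θ M ∷ substituteArgs θ Ms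

  infixl 5 _,ₛ_
  _,ₛ_ : Sub Γ Δ → Term Δ σ → Sub (σ ∷ Γ) Δ
  (θ ,ₛ N) Z     = N
  (θ ,ₛ N) (S x) = θ x

  infix 8 _[_]
  _[_] : Term (σ ∷ Γ) τ → Term Γ σ → Term Γ τ
  M [ N ] = substitute (var ,ₛ N) M

  weaken : Program σ → Term Γ σ
  weaken = rename λ ()

  -- The hole of a Context σ Γ τ may lie under binders.  It is only ever filled
  -- with closed terms of type σ, so filling it captures no variables.

  mutual
    data Context (σ : Ty) (Γ : Cx) : Ty → Set where
      □      : Context σ Γ σ
      fun    : Fun bs b → ArgsContext σ Γ bs → Context σ Γ (base b)
      if₁    : Context σ Γ (base bool) → Term Γ τ → Term Γ τ → Context σ Γ τ
      if₂    : Term Γ (base bool) → Context σ Γ τ → Term Γ τ → Context σ Γ τ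
      if₃    : Term Γ (base bool) → Term Γ τ → Context σ Γ τ → Context σ Γ τ
      or₁    : Context σ Γ τ → Term Γ τ → Context σ Γ τ
      or₂    : Term Γ τ → Context σ Γ τ → Context σ Γ τ
      ·₁     : Context σ Γ (base rew) → Term Γ τ → Context σ Γ τ
      ·₂     : Term Γ (base rew) → Context σ Γ τ → Context σ Γ τ
      mix₁   : I → Context σ Γ τ → Term Γ τ → Context σ Γ τ
      mix₂   : I → Term Γ τ → Context σ Γ τ → Context σ Γ τ
      pair₁  : Context σ Γ τ → Term Γ υ → Context σ Γ (τ ⊗ υ)
      pair₂  : Term Γ τ → Context σ Γ υ → Context σ Γ (τ ⊗ υ)
      fst    : Context σ Γ (τ ⊗ υ) → Context σ Γ τ
      snd    : Context σ Γ (τ ⊗ υ) → Context σ Γ υ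
      ƛ      : Context σ (τ ∷ Γ) υ → Context σ Γ (τ ⇒ υ)
      app₁   : Context σ Γ (τ ⇒ υ) → Term Γ τ → Context σ Γ υ
      app₂   : Term Γ (τ ⇒ υ) → Context σ Γ τ → Context σ Γ υ

    data ArgsContext (σ : Ty) (Γ : Cx) : List Base → Set where
      here  : Context σ Γ (base b) → Args Γ bs → ArgsContext σ Γ (b ∷ bs)
      there : Term Γ (base b) → ArgsContext σ Γ bs → ArgsContext σ Γ (b ∷ bs)

  fill     : Context σ Γ τ → Program σ → Term Γ τ
  fillArgs : ArgsContext σ Γ bs → Program σ → Args Γ bs

  fill □            L = weaken L
  fill (fun f C)    L = fun f (fillArgs C L)
  fill (if₁ C M N)  L = if (fill C L) M N
  fill (if₂ M C N)  L = if M (fill C L) N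
  fill (if₃ M N C)  L = if M N (fill C L)
  fill (or₁ C N)    L = fill C L or N
  fill (or₂ M C)    L = M or fill C L
  fill (·₁ C M)     L = fill C L · M
  fill (·₂ N C)     L = N · fill C L
  fill (mix₁ p C N) L = fill C L +[ p ] N
  fill (mix₂ p M C) L = M +[ p ] fill C L
  fill (pair₁ C N)  L = ⟨ fill C L , N ⟩
  fill (pair₂ M C)  L = ⟨ M , fill C L ⟩
  fill (fst C)      L = fst (fill C L)
  fill (snd C)      L = snd (fill C L)
  fill (ƛ C)        L = ƛ (fill C L)
  fill (app₁ C N)   L = app (fill C L) N
  fill (app₂ M C)   L = app M (fill C L)

  fillArgs (here C Ms) L = fill C L ∷ Ms
  fillArgs (there M C) L = M ∷ fillArgs C L

  data Val : Ty → Set where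
    con   : Con b → Val (base b)
    ∗     : Val unit
    ⟨_,_⟩ : Val σ → Val τ → Val (σ ⊗ τ)
    ƛ     : Term (σ ∷ []) τ → Val (σ ⇒ τ)

  ⌜_⌝ : Val σ → Program σ
  ⌜ con c ⌝     = con c
  ⌜ ∗ ⌝         = ∗
  ⌜ ⟨ V , W ⟩ ⌝ = ⟨ ⌜ V ⌝ , ⌜ W ⌝ ⟩
  ⌜ ƛ M ⌝       = ƛ M

  data EffVal (σ : Ty) : Set where
    value  : Val σ → EffVal σ
    _or_   : EffVal σ → EffVal σ → EffVal σ
    _·_    : Con rew → EffVal σ → EffVal σ
    _+[_]_ : EffVal σ → I → EffVal σ → EffVal σ

  mutual
    data EvalContext (σ : Ty) : Ty → Set where
      □     : EvalContext σ σ
      fun   : Fun bs b → ArgsEvalContext σ bs → EvalContext σ (base b)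
      if    : EvalContext σ (base bool) → Program τ → Program τ → EvalContext σ τ
      _·_   : EvalContext σ (base rew) → Program τ → EvalContext σ τ
      pair₁ : EvalContext σ τ → Program υ → EvalContext σ (τ ⊗ υ)
      pair₂ : Val τ → EvalContext σ υ → EvalContext σ (τ ⊗ υ)
      fst   : EvalContext σ (τ ⊗ υ) → EvalContext σ τ
      snd   : EvalContext σ (τ ⊗ υ) → EvalContext σ υ
      app₁  : EvalContext σ (τ ⇒ υ) → Program τ → EvalContext σ υ
      app₂  : Term (τ ∷ []) υ → EvalContext σ τ → EvalContext σ υ

    data ArgsEvalContext (σ : Ty) : List Base → Set where
      here  : EvalContext σ (base b) → Args [] bs → ArgsEvalContext σ (b ∷ bs)
      there : Con b → ArgsEvalContext σ bs → ArgsEvalContext σ (b ∷ bs)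

  infix 8 _⟪_⟫ _⟪_⟫ᵃ
  _⟪_⟫  : EvalContext σ τ → Program σ → Program τ
  _⟪_⟫ᵃ : ArgsEvalContext σ bs → Program σ → Args [] bs

  □ ⟪ Q ⟫         = Q
  fun f A ⟪ Q ⟫   = fun f (A ⟪ Q ⟫ᵃ)
  if K M N ⟪ Q ⟫  = if (K ⟪ Q ⟫) M N
  (K · M) ⟪ Q ⟫   = K ⟪ Q ⟫ · M
  pair₁ K N ⟪ Q ⟫ = ⟨ K ⟪ Q ⟫ , N ⟩
  pair₂ V K ⟪ Q ⟫ = ⟨ ⌜ V ⌝ , K ⟪ Q ⟫ ⟩
  fst K ⟪ Q ⟫     = fst (K ⟪ Q ⟫)
  snd K ⟪ Q ⟫     = snd (K ⟪ Q ⟫)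
  app₁ K N ⟪ Q ⟫  = app (K ⟪ Q ⟫) N
  app₂ M K ⟪ Q ⟫  = app (ƛ M) (K ⟪ Q ⟫)

  here K Ms ⟪ Q ⟫ᵃ = K ⟪ Q ⟫ ∷ Ms
  there c A ⟪ Q ⟫ᵃ = con c ∷ A ⟪ Q ⟫ᵃ

  infix 4 _⟶ᵣ_ _⟶_ _⇓_

  data _⟶ᵣ_ : Program σ → Program σ → Set where
    fun   : (f : Fun bs b) (cs : All Con bs) → fun f (All.map con cs) ⟶ᵣ con (val f cs)
    if-tt : {M N : Program σ} → if (con ttᶜ) M N ⟶ᵣ M
    if-ff : {M N : Program σ} → if (con ffᶜ) M N ⟶ᵣ N
    fst   : (V : Val σ) (W : Val τ) → fst ⟨ ⌜ V ⌝ , ⌜ W ⌝ ⟩ ⟶ᵣ ⌜ V ⌝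
    snd   : (V : Val σ) (W : Val τ) → snd ⟨ ⌜ V ⌝ , ⌜ W ⌝ ⟩ ⟶ᵣ ⌜ W ⌝
    β     : (M : Term (σ ∷ []) τ) (V : Val σ) → app (ƛ M) ⌜ V ⌝ ⟶ᵣ M [ ⌜ V ⌝ ]

  data _⟶_ : Program σ → Program σ → Set where
    inside : (K : EvalContext σ τ) {Q Q′ : Program σ} → Q ⟶ᵣ Q′ → K ⟪ Q ⟫ ⟶ K ⟪ Q′ ⟫

  -- The graph of Op.  Op itself is obtained below from a termination proof:
  -- every program M has some E with M ⇓ E, and only one, because a program
  -- that is not a value decomposes uniquely into an evaluation context and a
  -- redex or effect.

  data _⇓_ {σ : Ty} : Program σ → EffVal σ → Set where
    ⇓val  : (V : Val σ) → ⌜ V ⌝ ⇓ value V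
    ⇓step : ∀ {M M′ E} → M ⟶ M′ → M′ ⇓ E → M ⇓ E
    ⇓or   : (K : EvalContext τ σ) → ∀ {M₁ M₂ E₁ E₂} →
            K ⟪ M₁ ⟫ ⇓ E₁ → K ⟪ M₂ ⟫ ⇓ E₂ → K ⟪ M₁ or M₂ ⟫ ⇓ (E₁ or E₂)
    ⇓mix  : (K : EvalContext τ σ) → ∀ {p M₁ M₂ E₁ E₂} →
            K ⟪ M₁ ⟫ ⇓ E₁ → K ⟪ M₂ ⟫ ⇓ E₂ → K ⟪ M₁ +[ p ] M₂ ⟫ ⇓ (E₁ +[ p ] E₂)
    ⇓act  : (K : EvalContext τ σ) → ∀ {c M E} →
            K ⟪ M ⟫ ⇓ E → K ⟪ con c · M ⟫ ⇓ (c · E)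

  private
    cong₃ : ∀ {A B C D : Set} (f : A → B → C → D) {a a′ b b′ c c′} →
            a ≡ a′ → b ≡ b′ → c ≡ c′ → f a b c ≡ f a′ b′ c′
    cong₃ f refl refl refl = refl

  rename-rename : {ρ : Ren Γ Δ} {ρ′ : Ren Δ Θ} {ρ″ : Ren Γ Θ} →
                  (∀ {σ} (x : Γ ∋ σ) → ρ′ (ρ x) ≡ ρ″ x) →
                  (M : Term Γ σ) → rename ρ′ (rename ρ M) ≡ rename ρ″ M
  renameArgs-renameArgs : {ρ : Ren Γ Δ} {ρ′ : Ren Δ Θ} {ρ″ : Ren Γ Θ} →
                          (∀ {σ} (x : Γ ∋ σ) → ρ′ (ρ x) ≡ ρ″ x) →
                          (Ms : Args Γ bs) → renameArgs ρ′ (renameArgs ρ Ms) ≡ renameArgs ρ″ Ms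

  rename-rename h (var x)      = cong var (h x)
  rename-rename h (con c)      = refl
  rename-rename h (fun f Ms)   = cong (fun f) (renameArgs-renameArgs h Ms)
  rename-rename h (if L M N)   = cong₃ if (rename-rename h L) (rename-rename h M) (rename-rename h N)
  rename-rename h (M or N)     = cong₂ _or_ (rename-rename h M) (rename-rename h N)
  rename-rename h (N · M)      = cong₂ _·_ (rename-rename h N) (rename-rename h M)
  rename-rename h (M +[ p ] N) = cong₂ _+[ p ]_ (rename-rename h M) (rename-rename h N)
  rename-rename h ∗            = refl
  rename-rename h ⟨ M , N ⟩    = cong₂ ⟨_,_⟩ (rename-rename h M) (rename-rename h N)
  rename-rename h (fst M)      = cong fst (rename-rename h M)
  rename-rename h (snd M)      = cong snd (rename-rename h M)
  rename-rename h (ƛ M)        = cong ƛ (rename-rename (λ { Z → refl ; (S x) → cong S (h x) }) M)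
  rename-rename h (app M N)    = cong₂ app (rename-rename h M) (rename-rename h N)

  renameArgs-renameArgs h []       = refl
  renameArgs-renameArgs h (M ∷ Ms) = cong₂ _∷_ (rename-rename h M) (renameArgs-renameArgs h Ms)

  substitute-rename : {ρ : Ren Γ Δ} {θ : Sub Δ Θ} {θ′ : Sub Γ Θ} →
                      (∀ {σ} (x : Γ ∋ σ) → θ (ρ x) ≡ θ′ x) →
                      (M : Term Γ σ) → substitute θ (rename ρ M) ≡ substitute θ′ M
  substituteArgs-renameArgs : {ρ : Ren Γ Δ} {θ : Sub Δ Θ} {θ′ : Sub Γ Θ} →
                              (∀ {σ} (x : Γ ∋ σ) → θ (ρ x) ≡ θ′ x) →
                              (Ms : Args Γ bs) → substituteArgs θ (renameArgs ρ Ms) ≡ substituteArgs θ′ Ms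

  substitute-rename h (var x)      = h x
  substitute-rename h (con c)      = refl
  substitute-rename h (fun f Ms)   = cong (fun f) (substituteArgs-renameArgs h Ms)
  substitute-rename h (if L M N)   = cong₃ if (substitute-rename h L) (substitute-rename h M) (substitute-rename h N)
  substitute-rename h (M or N)     = cong₂ _or_ (substitute-rename h M) (substitute-rename h N)
  substitute-rename h (N · M)      = cong₂ _·_ (substitute-rename h N) (substitute-rename h M)
  substitute-rename h (M +[ p ] N) = cong₂ _+[ p ]_ (substitute-rename h M) (substitute-rename h N)
  substitute-rename h ∗            = refl
  substitute-rename h ⟨ M , N ⟩    = cong₂ ⟨_,_⟩ (substitute-rename h M) (substitute-rename h N)
  substitute-rename h (fst M)      = cong fst (substitute-rename h M)
  substitute-rename h (snd M)      = cong snd (substitute-rename h M)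
  substitute-rename h (ƛ M)        =
    cong ƛ (substitute-rename (λ { Z → refl ; (S x) → cong (rename S) (h x) }) M)
  substitute-rename h (app M N)    = cong₂ app (substitute-rename h M) (substitute-rename h N)

  substituteArgs-renameArgs h []       = refl
  substituteArgs-renameArgs h (M ∷ Ms) = cong₂ _∷_ (substitute-rename h M) (substituteArgs-renameArgs h Ms)

  rename-exts : (ρ : Ren Δ Θ) (M : Term Δ σ) →
                rename (ext {σ = τ} ρ) (rename S M) ≡ rename S (rename ρ M)
  rename-exts ρ M = trans (rename-rename (λ x → refl) M) (sym (rename-rename (λ x → refl) M))

  rename-substitute : {θ : Sub Γ Δ} {ρ : Ren Δ Θ} {θ′ : Sub Γ Θ} →
                      (∀ {σ} (x : Γ ∋ σ) → rename ρ (θ x) ≡ θ′ x) →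
                      (M : Term Γ σ) → rename ρ (substitute θ M) ≡ substitute θ′ M
  renameArgs-substituteArgs : {θ : Sub Γ Δ} {ρ : Ren Δ Θ} {θ′ : Sub Γ Θ} →
                              (∀ {σ} (x : Γ ∋ σ) → rename ρ (θ x) ≡ θ′ x) →
                              (Ms : Args Γ bs) → renameArgs ρ (substituteArgs θ Ms) ≡ substituteArgs θ′ Ms

  rename-substitute h (var x)      = h x
  rename-substitute h (con c)      = refl
  rename-substitute h (fun f Ms)   = cong (fun f) (renameArgs-substituteArgs h Ms)
  rename-substitute h (if L M N)   = cong₃ if (rename-substitute h L) (rename-substitute h M) (rename-substitute h N)
  rename-substitute h (M or N)     = cong₂ _or_ (rename-substitute h M) (rename-substitute h N)
  rename-substitute h (N · M)      = cong₂ _·_ (rename-substitute h N) (rename-substitute h M)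
  rename-substitute h (M +[ p ] N) = cong₂ _+[ p ]_ (rename-substitute h M) (rename-substitute h N)
  rename-substitute h ∗            = refl
  rename-substitute h ⟨ M , N ⟩    = cong₂ ⟨_,_⟩ (rename-substitute h M) (rename-substitute h N)
  rename-substitute h (fst M)      = cong fst (rename-substitute h M)
  rename-substitute h (snd M)      = cong snd (rename-substitute h M)
  rename-substitute {θ = θ} {ρ} h (ƛ M) =
    cong ƛ (rename-substitute
      (λ { Z → refl ; (S x) → trans (rename-exts ρ (θ x)) (cong (rename S) (h x)) }) M)
  rename-substitute h (app M N)    = cong₂ app (rename-substitute h M) (rename-substitute h N)

  renameArgs-substituteArgs h []       = refl
  renameArgs-substituteArgs h (M ∷ Ms) = cong₂ _∷_ (rename-substitute h M) (renameArgs-substituteArgs h Ms)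

  substitute-exts : (θ : Sub Δ Θ) (M : Term Δ σ) →
                    substitute (exts {σ = τ} θ) (rename S M) ≡ rename S (substitute θ M)
  substitute-exts θ M = trans (substitute-rename (λ x → refl) M) (sym (rename-substitute (λ x → refl) M))

  substitute-substitute : {θ : Sub Γ Δ} {θ′ : Sub Δ Θ} {θ″ : Sub Γ Θ} →
                          (∀ {σ} (x : Γ ∋ σ) → substitute θ′ (θ x) ≡ θ″ x) →
                          (M : Term Γ σ) → substitute θ′ (substitute θ M) ≡ substitute θ″ M
  substituteArgs-substituteArgs : {θ : Sub Γ Δ} {θ′ : Sub Δ Θ} {θ″ : Sub Γ Θ} →
                                  (∀ {σ} (x : Γ ∋ σ) → substitute θ′ (θ x) ≡ θ″ x) →
                                  (Ms : Args Γ bs) →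
                                  substituteArgs θ′ (substituteArgs θ Ms) ≡ substituteArgs θ″ Ms

  substitute-substitute h (var x)      = h x
  substitute-substitute h (con c)      = refl
  substitute-substitute h (fun f Ms)   = cong (fun f) (substituteArgs-substituteArgs h Ms)
  substitute-substitute h (if L M N)   =
    cong₃ if (substitute-substitute h L) (substitute-substitute h M) (substitute-substitute h N)
  substitute-substitute h (M or N)     = cong₂ _or_ (substitute-substitute h M) (substitute-substitute h N)
  substitute-substitute h (N · M)      = cong₂ _·_ (substitute-substitute h N) (substitute-substitute h M)
  substitute-substitute h (M +[ p ] N) = cong₂ _+[ p ]_ (substitute-substitute h M) (substitute-substitute h N)
  substitute-substitute h ∗            = refl
  substitute-substitute h ⟨ M , N ⟩    = cong₂ ⟨_,_⟩ (substitute-substitute h M) (substitute-substitute h N)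
  substitute-substitute h (fst M)      = cong fst (substitute-substitute h M)
  substitute-substitute h (snd M)      = cong snd (substitute-substitute h M)
  substitute-substitute {θ = θ} {θ′} h (ƛ M) =
    cong ƛ (substitute-substitute
      (λ { Z → refl ; (S x) → trans (substitute-exts θ′ (θ x)) (cong (rename S) (h x)) }) M)
  substitute-substitute h (app M N)    = cong₂ app (substitute-substitute h M) (substitute-substitute h N)

  substituteArgs-substituteArgs h []       = refl
  substituteArgs-substituteArgs h (M ∷ Ms) =
    cong₂ _∷_ (substitute-substitute h M) (substituteArgs-substituteArgs h Ms)

  substitute-id : {θ : Sub Γ Γ} → (∀ {σ} (x : Γ ∋ σ) → θ x ≡ var x) →
                  (M : Term Γ σ) → substitute θ M ≡ M
  substituteArgs-id : {θ : Sub Γ Γ} → (∀ {σ} (x : Γ ∋ σ) → θ x ≡ var x) →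
                      (Ms : Args Γ bs) → substituteArgs θ Ms ≡ Ms

  substitute-id h (var x)      = h x
  substitute-id h (con c)      = refl
  substitute-id h (fun f Ms)   = cong (fun f) (substituteArgs-id h Ms)
  substitute-id h (if L M N)   = cong₃ if (substitute-id h L) (substitute-id h M) (substitute-id h N)
  substitute-id h (M or N)     = cong₂ _or_ (substitute-id h M) (substitute-id h N)
  substitute-id h (N · M)      = cong₂ _·_ (substitute-id h N) (substitute-id h M)
  substitute-id h (M +[ p ] N) = cong₂ _+[ p ]_ (substitute-id h M) (substitute-id h N)
  substitute-id h ∗            = refl
  substitute-id h ⟨ M , N ⟩    = cong₂ ⟨_,_⟩ (substitute-id h M) (substitute-id h N)
  substitute-id h (fst M)      = cong fst (substitute-id h M)
  substitute-id h (snd M)      = cong snd (substitute-id h M)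
  substitute-id h (ƛ M)        = cong ƛ (substitute-id (λ { Z → refl ; (S x) → cong (rename S) (h x) }) M)
  substitute-id h (app M N)    = cong₂ app (substitute-id h M) (substitute-id h N)

  substituteArgs-id h []       = refl
  substituteArgs-id h (M ∷ Ms) = cong₂ _∷_ (substitute-id h M) (substituteArgs-id h Ms)

  substitute-β : (θ : Sub Γ []) (M : Term (σ ∷ Γ) τ) (N : Program σ) →
                 substitute (exts θ) M [ N ] ≡ substitute (θ ,ₛ N) M
  substitute-β θ M N = substitute-substitute
    (λ { Z     → refl
       ; (S x) → trans (substitute-rename (λ _ → refl) (θ x)) (substitute-id (λ _ → refl) (θ x)) }) M

  mutual
    _⊙_ : EvalContext τ υ → EvalContext σ τ → EvalContext σ υ
    □         ⊙ J = J
    fun f A   ⊙ J = fun f (A ⊙ᵃ J)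
    if K M N  ⊙ J = if (K ⊙ J) M N
    (K · M)   ⊙ J = (K ⊙ J) · M
    pair₁ K N ⊙ J = pair₁ (K ⊙ J) N
    pair₂ V K ⊙ J = pair₂ V (K ⊙ J)
    fst K     ⊙ J = fst (K ⊙ J)
    snd K     ⊙ J = snd (K ⊙ J)
    app₁ K N  ⊙ J = app₁ (K ⊙ J) N
    app₂ M K  ⊙ J = app₂ M (K ⊙ J)

    _⊙ᵃ_ : ArgsEvalContext τ bs → EvalContext σ τ → ArgsEvalContext σ bs
    here K Ms ⊙ᵃ J = here (K ⊙ J) Ms
    there c A ⊙ᵃ J = there c (A ⊙ᵃ J)

  mutual
    ⊙-⟪⟫ : (K : EvalContext τ υ) (J : EvalContext σ τ) (Q : Program σ) →
           (K ⊙ J) ⟪ Q ⟫ ≡ K ⟪ J ⟪ Q ⟫ ⟫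
    ⊙-⟪⟫ □           J Q = refl
    ⊙-⟪⟫ (fun f A)   J Q = cong (fun f) (⊙ᵃ-⟪⟫ A J Q)
    ⊙-⟪⟫ (if K M N)  J Q = cong (λ L → if L M N) (⊙-⟪⟫ K J Q)
    ⊙-⟪⟫ (K · M)     J Q = cong (_· M) (⊙-⟪⟫ K J Q)
    ⊙-⟪⟫ (pair₁ K N) J Q = cong ⟨_, N ⟩ (⊙-⟪⟫ K J Q)
    ⊙-⟪⟫ (pair₂ V K) J Q = cong ⟨ ⌜ V ⌝ ,_⟩ (⊙-⟪⟫ K J Q)
    ⊙-⟪⟫ (fst K)     J Q = cong fst (⊙-⟪⟫ K J Q)
    ⊙-⟪⟫ (snd K)     J Q = cong snd (⊙-⟪⟫ K J Q)
    ⊙-⟪⟫ (app₁ K N)  J Q = cong (λ L → app L N) (⊙-⟪⟫ K J Q)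
    ⊙-⟪⟫ (app₂ M K)  J Q = cong (app (ƛ M)) (⊙-⟪⟫ K J Q)

    ⊙ᵃ-⟪⟫ : (A : ArgsEvalContext τ bs) (J : EvalContext σ τ) (Q : Program σ) →
            (A ⊙ᵃ J) ⟪ Q ⟫ᵃ ≡ A ⟪ J ⟪ Q ⟫ ⟫ᵃ
    ⊙ᵃ-⟪⟫ (here K Ms) J Q = cong (_∷ Ms) (⊙-⟪⟫ K J Q)
    ⊙ᵃ-⟪⟫ (there c A) J Q = cong (con c ∷_) (⊙ᵃ-⟪⟫ A J Q)

  AllLeaves : (Val σ → Set) → EffVal σ → Set
  AllLeaves P (value V)      = P V
  AllLeaves P (E or F)       = AllLeaves P E × AllLeaves P F
  AllLeaves P (c · E)        = AllLeaves P E
  AllLeaves P (E +[ p ] F)   = AllLeaves P E × AllLeaves P F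

  Halts : (Val σ → Set) → Program σ → Set
  Halts P M = ∃[ E ] (M ⇓ E × AllLeaves P E)

  ⇓-bind : {P : Val υ → Set} (K : EvalContext σ υ) {M : Program σ} {E : EffVal σ} → M ⇓ E →
           AllLeaves (λ V → Halts P (K ⟪ ⌜ V ⌝ ⟫)) E → Halts P (K ⟪ M ⟫)
  ⇓-bind K (⇓val V) h = h
  ⇓-bind K (⇓step (inside J {Q} {Q′} r) d) h with ⇓-bind K d h
  ... | E , e , l = E , subst (_⇓ E) (⊙-⟪⟫ K J Q)
                          (⇓step (inside (K ⊙ J) r) (subst (_⇓ E) (sym (⊙-⟪⟫ K J Q′)) e)) , l
  ⇓-bind K (⇓or J {M₁} {M₂} d₁ d₂) (h₁ , h₂) with ⇓-bind K d₁ h₁ | ⇓-bind K d₂ h₂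
  ... | E₁ , e₁ , l₁ | E₂ , e₂ , l₂ =
    (E₁ or E₂) , subst (_⇓ (E₁ or E₂)) (⊙-⟪⟫ K J (M₁ or M₂))
      (⇓or (K ⊙ J) (subst (_⇓ E₁) (sym (⊙-⟪⟫ K J M₁)) e₁)
                   (subst (_⇓ E₂) (sym (⊙-⟪⟫ K J M₂)) e₂)) , l₁ , l₂
  ⇓-bind K (⇓mix J {p} {M₁} {M₂} d₁ d₂) (h₁ , h₂) with ⇓-bind K d₁ h₁ | ⇓-bind K d₂ h₂
  ... | E₁ , e₁ , l₁ | E₂ , e₂ , l₂ =
    (E₁ +[ p ] E₂) , subst (_⇓ (E₁ +[ p ] E₂)) (⊙-⟪⟫ K J (M₁ +[ p ] M₂))
      (⇓mix (K ⊙ J) (subst (_⇓ E₁) (sym (⊙-⟪⟫ K J M₁)) e₁)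
                    (subst (_⇓ E₂) (sym (⊙-⟪⟫ K J M₂)) e₂)) , l₁ , l₂
  ⇓-bind K (⇓act J {c} {M} d) h with ⇓-bind K d h
  ... | E , e , l = (c · E) , subst (_⇓ (c · E)) (⊙-⟪⟫ K J (con c · M))
                      (⇓act (K ⊙ J) (subst (_⇓ E) (sym (⊙-⟪⟫ K J M)) e)) , l

  AllLeaves-map : {P Q : Val σ → Set} → (∀ V → P V → Q V) → ∀ E → AllLeaves P E → AllLeaves Q E
  AllLeaves-map f (value V)    h         = f V h
  AllLeaves-map f (E or F)     (h₁ , h₂) = AllLeaves-map f E h₁ , AllLeaves-map f F h₂
  AllLeaves-map f (c · E)      h         = AllLeaves-map f E h
  AllLeaves-map f (E +[ p ] F) (h₁ , h₂) = AllLeaves-map f E h₁ , AllLeaves-map f F h₂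

  bind : {P : Val σ → Set} {P′ : Val υ → Set} (K : EvalContext σ υ) {M : Program σ} →
         Halts P M → (∀ V → P V → Halts P′ (K ⟪ ⌜ V ⌝ ⟫)) → Halts P′ (K ⟪ M ⟫)
  bind K (E , d , l) f = ⇓-bind K d (AllLeaves-map f E l)

  step : {P : Val σ → Set} {Q Q′ : Program σ} → Q ⟶ᵣ Q′ → Halts P Q′ → Halts P Q
  step r (E , d , l) = E , ⇓step (inside □ r) d , l

  -- Termination, by Tait's method.  It needs every constant of type bool to be
  -- tt or ff, which holds as soon as distinct constants denote distinct values.

  Reducible : (σ : Ty) → Val σ → Set
  Reducible (base b) V         = ⊤
  Reducible unit     V         = ⊤
  Reducible (σ ⊗ τ)  ⟨ V , W ⟩ = Reducible σ V × Reducible τ W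
  Reducible (σ ⇒ τ)  (ƛ M)     = ∀ V → Reducible σ V → Halts (Reducible τ) (M [ ⌜ V ⌝ ])

  -- The evaluated arguments of a function symbol, to the left of the current one.

  data Prefix : List Base → List Base → Set where
    []  : Prefix bs bs
    _∷_ : Con b → Prefix (b ∷ bs) ds → Prefix bs ds

  _⊳_ : Prefix bs ds → Args [] bs → Args [] ds
  []      ⊳ Ms = Ms
  (c ∷ p) ⊳ Ms = p ⊳ (con c ∷ Ms)

  _⊳ᶜ_ : Prefix bs ds → All Con bs → All Con ds
  []      ⊳ᶜ cs = cs
  (c ∷ p) ⊳ᶜ cs = p ⊳ᶜ (c ∷ cs)

  _⊳ᵏ_ : Prefix bs ds → ArgsEvalContext σ bs → ArgsEvalContext σ ds
  []      ⊳ᵏ A = A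
  (c ∷ p) ⊳ᵏ A = p ⊳ᵏ there c A

  ⊳ᶜ-con : (p : Prefix bs ds) (cs : All Con bs) → p ⊳ All.map con cs ≡ All.map con (p ⊳ᶜ cs)
  ⊳ᶜ-con []      cs = refl
  ⊳ᶜ-con (c ∷ p) cs = ⊳ᶜ-con p (c ∷ cs)

  ⊳ᵏ-⟪⟫ : (p : Prefix bs ds) (A : ArgsEvalContext σ bs) (Q : Program σ) →
          (p ⊳ᵏ A) ⟪ Q ⟫ᵃ ≡ p ⊳ (A ⟪ Q ⟫ᵃ)
  ⊳ᵏ-⟪⟫ []      A Q = refl
  ⊳ᵏ-⟪⟫ (c ∷ p) A Q = ⊳ᵏ-⟪⟫ p (there c A) Q

  Halting : Args [] bs → Set
  Halting []       = ⊤
  Halting (M ∷ Ms) = Halts (λ _ → ⊤) M × Halting Ms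

  halts-fun : (f : Fun ds b) (p : Prefix bs ds) (Ms : Args [] bs) → Halting Ms →
              Halts (λ _ → ⊤) (fun f (p ⊳ Ms))
  halts-fun f p [] _ =
    subst (Halts _ ∘ fun f) (sym (⊳ᶜ-con p []))
      (step (fun f (p ⊳ᶜ [])) (value (con (val f (p ⊳ᶜ []))) , ⇓val (con _) , tt))
  halts-fun f p (M ∷ Ms) (h , hs) =
    subst (Halts _ ∘ fun f) (⊳ᵏ-⟪⟫ p (here □ Ms) M)
      (bind (fun f (p ⊳ᵏ here □ Ms)) h λ
        { (con c) _ → subst (Halts _ ∘ fun f) (sym (⊳ᵏ-⟪⟫ p (here □ Ms) (con c)))
                        (halts-fun f (c ∷ p) Ms hs) })

  module Evaluation (bool-con : (c : Con bool) → c ≡ ttᶜ ⊎ c ≡ ffᶜ) where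

    Env : Cx → Set
    Env Γ = ∀ {σ} → Γ ∋ σ → Σ (Val σ) (Reducible σ)

    toSub : Env Γ → Sub Γ []
    toSub γ x = ⌜ proj₁ (γ x) ⌝

    _,ₑ_ : Env Γ → Σ (Val σ) (Reducible σ) → Env (σ ∷ Γ)
    (γ ,ₑ V) Z     = V
    (γ ,ₑ V) (S x) = γ x

    halts     : (M : Term Γ σ) (γ : Env Γ) {θ : Sub Γ []} →
                (∀ {τ} (x : Γ ∋ τ) → θ x ≡ toSub γ x) → Halts (Reducible σ) (substitute θ M)
    haltsArgs : (Ms : Args Γ bs) (γ : Env Γ) {θ : Sub Γ []} →
                (∀ {τ} (x : Γ ∋ τ) → θ x ≡ toSub γ x) → Halting (substituteArgs θ Ms)

    halts (var x) γ h rewrite h x = value (proj₁ (γ x)) , ⇓val _ , proj₂ (γ x)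
    halts (con c) γ h = value (con c) , ⇓val _ , tt
    halts (fun f Ms) γ h = halts-fun f [] _ (haltsArgs Ms γ h)
    halts (if L M N) γ {θ} h = bind (if □ _ _) (halts L γ h) λ { (con c) _ → branch c (bool-con c) }
      where
      branch : ∀ c → c ≡ ttᶜ ⊎ c ≡ ffᶜ →
               Halts (Reducible _) (if (con c) (substitute θ M) (substitute θ N))
      branch c (inj₁ refl) = step if-tt (halts M γ h)
      branch c (inj₂ refl) = step if-ff (halts N γ h)
    halts (M or N) γ h with halts M γ h | halts N γ h
    ... | E , d , l | F , e , k = (E or F) , ⇓or □ d e , l , k
    halts (N · M) γ {θ} h = bind (□ · _) (halts N γ h) λ { (con c) _ → act c (halts M γ h) }
      where
      act : ∀ c → Halts (Reducible _) (substitute θ M) →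
            Halts (Reducible _) (con c · substitute θ M)
      act c (E , d , l) = (c · E) , ⇓act □ d , l
    halts (M +[ p ] N) γ h with halts M γ h | halts N γ h
    ... | E , d , l | F , e , k = (E +[ p ] F) , ⇓mix □ d e , l , k
    halts ∗ γ h = value ∗ , ⇓val ∗ , tt
    halts ⟨ M , N ⟩ γ h =
      bind (pair₁ □ _) (halts M γ h) λ V v →
      bind (pair₂ V □) (halts N γ h) λ W w →
      value ⟨ V , W ⟩ , ⇓val ⟨ V , W ⟩ , v , w
    halts (fst M) γ h = bind (fst □) (halts M γ h) λ
      { ⟨ V , W ⟩ (v , w) → step (fst V W) (value V , ⇓val V , v) }
    halts (snd M) γ h = bind (snd □) (halts M γ h) λ
      { ⟨ V , W ⟩ (v , w) → step (snd V W) (value W , ⇓val W , w) }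
    halts (ƛ M) γ {θ} h = value (ƛ _) , ⇓val (ƛ _) , λ V v →
      subst (Halts _) (sym (substitute-β θ M ⌜ V ⌝))
        (halts M (γ ,ₑ (V , v)) λ { Z → refl ; (S x) → h x })
    halts (app M N) γ h =
      bind (app₁ □ _) (halts M γ h) λ { (ƛ L) l →
      bind (app₂ L □) (halts N γ h) λ V v →
      step (β L V) (l V v) }

    haltsArgs []       γ h = tt
    haltsArgs (M ∷ Ms) γ h with halts M γ h
    ... | E , d , l = (E , d , AllLeaves-map (λ _ _ → tt) E l) , haltsArgs Ms γ h

    halts-program : (M : Program σ) → Halts (Reducible σ) M
    halts-program M =
      subst (Halts (Reducible _)) (substitute-id (λ ()) M) (halts M (λ ()) {λ ()} (λ ()))

    Op : Program σ → EffVal σ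
    Op M = proj₁ (halts-program M)

    ⇓-Op : (M : Program σ) → M ⇓ Op M
    ⇓-Op M = proj₁ (proj₂ (halts-program M))

-- The metatheory is classical: em decides the order of rewards in the choice
-- operator, and whether a weight is 1 in a convex combination.

module Semantics
  (em : ExcludedMiddle 0ℓ)
  (ℝ  : CompleteOrderedField)
  (𝓡  : Structures.RewardAlgebra ℝ)
  (Sg : Structures.Signature ℝ)
  (𝓘  : Structures.Interpretation ℝ 𝓡 Sg)
  (𝓣  : Structures.AuxiliaryMonad ℝ 𝓡)
  where

  open Convexity ℝ
  open Structures ℝ
  open Syntax ℝ Sg
  open Signature Sg
  open Interpretation 𝓘
  private
    module R = RewardAlgebra 𝓡
    module T = AuxiliaryMonad 𝓣
  open RewardAlgebra 𝓡 using (R)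
  open IsTotalOrder R.isTotalOrder using (total) renaming (refl to ≤-refl; trans to ≤-trans)
  open AuxiliaryMonad 𝓣 using (T)

  private
    variable
      X Y   : Set
      Γ     : Cx
      σ τ   : Ty
      b     : Base
      bs    : List Base

  bool-con : (c : Con bool) → c ≡ ttᶜ ⊎ c ≡ ffᶜ
  bool-con c with ⟦ c ⟧con in eq
  ... | true  = inj₁ (con-injective (trans eq (sym ⟦tt⟧)))
  ... | false = inj₂ (con-injective (trans eq (sym ⟦ff⟧)))

  open Evaluation bool-con public using (Op; ⇓-Op)

  DW : Set → Set
  DW X = Dist (R × X)

  infixr 7 _·ᴰ_
  _·ᴰ_ : R → DW X → DW X
  r ·ᴰ D = mapDist (map₁ (r R.+_)) D

  𝐄 : DW X → R
  𝐄 D = convex em R._+[_]_ (mapDist proj₁ D)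

  Str : EffVal σ → Set
  Str (value V)    = ⊤
  Str (E or F)     = Str E ⊎ Str F
  Str (c · E)      = Str E
  Str (E +[ p ] F) = Str E × Str F

  Out : (E : EffVal σ) → Str E → DW (Val σ)
  Out (value V)    _         = dirac (R.0# , V)
  Out (E or F)     (inj₁ s)  = Out E s
  Out (E or F)     (inj₂ s)  = Out F s
  Out (c · E)      s         = ⟦ c ⟧con ·ᴰ Out E s
  Out (E +[ p ] F) (s₁ , s₂) = mixDist p (Out E s₁) (Out F s₂)

  Rew : (E : EffVal σ) → Str E → R
  Rew E s = 𝐄 (Out E s)

  _≺_ : {E : EffVal σ} → Rel (Str E) 0ℓ
  _≺_ {E = value V}    = λ _ _ → ⊥
  _≺_ {E = E or F}     = _≺_ {E = E} ⊎-< _≺_ {E = F}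
  _≺_ {E = c · E}      = _≺_ {E = E}
  _≺_ {E = E +[ p ] F} = ×-Lex _≡_ (_≺_ {E = E}) (_≺_ {E = F})

  module _ (E : EffVal σ) (f : Str E → R) where

    IsMaximizer : Str E → Set
    IsMaximizer s = ∀ t → f t R.≤ f s

    IsLeastMaximizer : Str E → Set
    IsLeastMaximizer s = IsMaximizer s × (∀ t → IsMaximizer t → s ≡ t ⊎ _≺_ {E = E} s t)

  leastMaximizer : (E : EffVal σ) (f : Str E → R) → ∃ (IsLeastMaximizer E f)
  leastMaximizer (value V) f = tt , (λ _ → ≤-refl) , λ _ _ → inj₁ refl
  leastMaximizer (c · E) f = leastMaximizer E f
  leastMaximizer (E or F) f with leastMaximizer E (f ∘ inj₁) | leastMaximizer F (f ∘ inj₂)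
  ... | s , sMax , sLeast | t , tMax , tLeast with em {f (inj₂ t) R.≤ f (inj₁ s)}
  ...   | yes t≤s = inj₁ s , max , least
    where
    max : IsMaximizer (E or F) f (inj₁ s)
    max (inj₁ u) = sMax u
    max (inj₂ u) = ≤-trans (tMax u) t≤s
    least : ∀ u → IsMaximizer (E or F) f u → inj₁ s ≡ u ⊎ _≺_ {E = E or F} (inj₁ s) u
    least (inj₁ u) uMax with sLeast u (uMax ∘ inj₁)
    ... | inj₁ s≡u = inj₁ (cong inj₁ s≡u)
    ... | inj₂ s≺u = inj₂ (₁∼₁ s≺u)
    least (inj₂ u) uMax = inj₂ ₁∼₂
  ...   | no t≰s = inj₂ t , max , least
    where
    s≤t : f (inj₁ s) R.≤ f (inj₂ t)
    s≤t with total (f (inj₁ s)) (f (inj₂ t))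
    ... | inj₁ h = h
    ... | inj₂ h = contradiction h t≰s
    max : IsMaximizer (E or F) f (inj₂ t)
    max (inj₁ u) = ≤-trans (sMax u) s≤t
    max (inj₂ u) = tMax u
    least : ∀ u → IsMaximizer (E or F) f u → inj₂ t ≡ u ⊎ _≺_ {E = E or F} (inj₂ t) u
    least (inj₁ u) uMax = contradiction (≤-trans (uMax (inj₂ t)) (sMax u)) t≰s
    least (inj₂ u) uMax with tLeast u (uMax ∘ inj₂)
    ... | inj₁ t≡u = inj₁ (cong inj₂ t≡u)
    ... | inj₂ t≺u = inj₂ (₂∼₂ t≺u)
  leastMaximizer (E +[ p ] F) f = (s , t s) , max , least
    where
    best : ∀ u → ∃ (IsLeastMaximizer F (λ v → f (u , v)))
    best u = leastMaximizer F (λ v → f (u , v))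
    t : Str E → Str F
    t u = proj₁ (best u)
    outer : ∃ (IsLeastMaximizer E (λ u → f (u , t u)))
    outer = leastMaximizer E (λ u → f (u , t u))
    s : Str E
    s = proj₁ outer
    max : IsMaximizer (E +[ p ] F) f (s , t s)
    max (u , v) = ≤-trans (proj₁ (proj₂ (best u)) v) (proj₁ (proj₂ outer) u)
    least : ∀ w → IsMaximizer (E +[ p ] F) f w →
            (s , t s) ≡ w ⊎ _≺_ {E = E +[ p ] F} (s , t s) w
    least (u , v) uvMax
      with proj₂ (proj₂ outer) u
             (λ u′ → ≤-trans (uvMax (u′ , t u′)) (proj₁ (proj₂ (best u)) v))
    ... | inj₂ s≺u = inj₂ (inj₁ s≺u)
    ... | inj₁ refl with proj₂ (proj₂ (best s)) v (λ v′ → uvMax (s , v′))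
    ...   | inj₁ t≡v = inj₁ (cong (s ,_) t≡v)
    ...   | inj₂ t≺v = inj₂ (inj₂ (refl , t≺v))

  s-opt : (E : EffVal σ) → Str E
  s-opt E = proj₁ (leastMaximizer E (Rew E))

  Opₛ : Program σ → DW (Val σ)
  Opₛ M = Out (Op M) (s-opt (Op M))

  S̲ : Set → Set
  S̲ X = (X → R) → T X

  𝐑 : S̲ X → (X → R) → R
  𝐑 F γ = T.α (T.map γ (F γ))

  ηˢ : X → S̲ X
  ηˢ x γ = T.η x

  infix 10 _†ˢ
  _†ˢ : (X → S̲ Y) → S̲ X → S̲ Y
  (f †ˢ) F γ = ((λ x → f x γ) T.†) (F (λ x → 𝐑 (f x) γ))

  infixr 5 _orˢ_
  _orˢ_ : S̲ X → S̲ X → S̲ X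
  (G₀ orˢ G₁) γ = if ⌊ em {𝐑 G₁ γ R.≤ 𝐑 G₀ γ} ⌋ then G₀ γ else G₁ γ

  infixr 7 _·ˢ_
  _·ˢ_ : R → S̲ X → S̲ X
  (r ·ˢ G) γ = r T.· G γ

  _+ˢ[_]_ : S̲ X → I → S̲ X → S̲ X
  (F +ˢ[ p ] G) γ = F γ T.+[ p ] G γ

  𝒮⟦_⟧ᵗ : Ty → Set
  𝒮⟦ base b ⟧ᵗ = ⟦ b ⟧base
  𝒮⟦ unit ⟧ᵗ   = ⊤
  𝒮⟦ σ ⊗ τ ⟧ᵗ  = 𝒮⟦ σ ⟧ᵗ × 𝒮⟦ τ ⟧ᵗ
  𝒮⟦ σ ⇒ τ ⟧ᵗ  = 𝒮⟦ σ ⟧ᵗ → S̲ 𝒮⟦ τ ⟧ᵗ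

  𝒮⟦_⟧ᶜ : Cx → Set
  𝒮⟦ Γ ⟧ᶜ = All 𝒮⟦_⟧ᵗ Γ

  lookup : 𝒮⟦ Γ ⟧ᶜ → Γ ∋ σ → 𝒮⟦ σ ⟧ᵗ
  lookup (a ∷ ρ) Z     = a
  lookup (a ∷ ρ) (S x) = lookup ρ x

  𝒮⟦_⟧     : Term Γ σ → 𝒮⟦ Γ ⟧ᶜ → S̲ 𝒮⟦ σ ⟧ᵗ
  𝒮⟦_⟧args : Args Γ bs → 𝒮⟦ Γ ⟧ᶜ → S̲ (All ⟦_⟧base bs)

  𝒮⟦ var x ⟧ ρ      = ηˢ (lookup ρ x)
  𝒮⟦ con c ⟧ ρ      = ηˢ ⟦ c ⟧con
  𝒮⟦ fun f Ms ⟧ ρ   = ((λ as → ηˢ (⟦ f ⟧fun as)) †ˢ) (𝒮⟦ Ms ⟧args ρ)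
  𝒮⟦ if L M N ⟧ ρ   = ((λ t → if t then 𝒮⟦ M ⟧ ρ else 𝒮⟦ N ⟧ ρ) †ˢ) (𝒮⟦ L ⟧ ρ)
  𝒮⟦ M or N ⟧ ρ     = 𝒮⟦ M ⟧ ρ orˢ 𝒮⟦ N ⟧ ρ
  𝒮⟦ N · M ⟧ ρ      = ((λ r → r ·ˢ 𝒮⟦ M ⟧ ρ) †ˢ) (𝒮⟦ N ⟧ ρ)
  𝒮⟦ M +[ p ] N ⟧ ρ = 𝒮⟦ M ⟧ ρ +ˢ[ p ] 𝒮⟦ N ⟧ ρ
  𝒮⟦ ∗ ⟧ ρ          = ηˢ tt
  𝒮⟦ ⟨ M , N ⟩ ⟧ ρ  = ((λ a → ((λ b → ηˢ (a , b)) †ˢ) (𝒮⟦ N ⟧ ρ)) †ˢ) (𝒮⟦ M ⟧ ρ)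
  𝒮⟦ fst M ⟧ ρ      = ((λ ab → ηˢ (proj₁ ab)) †ˢ) (𝒮⟦ M ⟧ ρ)
  𝒮⟦ snd M ⟧ ρ      = ((λ ab → ηˢ (proj₂ ab)) †ˢ) (𝒮⟦ M ⟧ ρ)
  𝒮⟦ ƛ M ⟧ ρ        = ηˢ (λ a → 𝒮⟦ M ⟧ (a ∷ ρ))
  𝒮⟦ app M N ⟧ ρ    = ((λ f → (f †ˢ) (𝒮⟦ N ⟧ ρ)) †ˢ) (𝒮⟦ M ⟧ ρ)

  𝒮⟦ [] ⟧args ρ     = ηˢ []
  𝒮⟦ M ∷ Ms ⟧args ρ = ((λ a → ((λ as → ηˢ (a ∷ as)) †ˢ) (𝒮⟦ Ms ⟧args ρ)) †ˢ) (𝒮⟦ M ⟧ ρ)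

  θ : DW X → T X
  θ D = convex em T._+[_]_ (mapDist (λ (r , x) → r T.· T.η x) D)

  Ob : Program (base bool) → T (Val (base bool))
  Ob M = θ (Opₛ M)

  infix 4 _≈_
  _≈_ : Program σ → Program σ → Set
  _≈_ {σ} M N = ∀ (C : Context σ [] (base bool)) → Ob (fill C M) ≡ Ob (fill C N)

  BoolCharacteristic : Set₁
  BoolCharacteristic =
    ∀ {X} (u v : T X) → u ≢ v → ∃[ f ] T.map {Y = Bool} f u ≢ T.map f v

  rewardAdd : (X → R) → T X → T X
  rewardAdd γ = (λ x → γ x T.· T.η x) T.†

  RewardAdditionInjective : Set₁
  RewardAdditionInjective = ∀ {X} (γ : X → R) → Injective _≡_ _≡_ (rewardAdd γ)

  Numerable : Set
  Numerable = ∀ r → ∃[ c ] ⟦_⟧con {rew} c ≡ r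

{-# OPTIONS --safe #-}

-- Evaluation is sound: the choice, reward and mixing operations of the selection monad
-- commute with Kleisli extension, so 𝒮⟦ M ⟧ is the denotation of the effect value of M.
-- At the zero reward continuation this denotation selects exactly the least optimal
-- strategy, whence 𝒮⟦ M ⟧ 0 = T ⟦_⟧ (Ob M) for boolean M (adequacy).
--
-- Suppose 𝒮⟦ M ⟧ γ ≠ 𝒮⟦ N ⟧ γ.  Injectivity of reward addition and the characteristic
-- property give f : ⟦b⟧ → {0,1} with T f (k_γ (𝒮⟦ M ⟧ γ)) ≠ T f (k_γ (𝒮⟦ N ⟧ γ)).  These are
-- the denotations at 0 of M and N in the context "let x be [ ] in γ(x) · f(x)", because the
-- expected reward of γ(x) · f(x) at 0 is γ(x).  Only the finitely many constants that
-- occur in the effect values of M and N matter, and on those γ and f are definable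
-- by nested conditionals.

module Submission where

open import Algebra.Bundles using (CommutativeRing)
import Algebra.Properties.Ring as RingProperties
open import Algebra.Structures using (IsCommutativeMonoid)
open import Axiom.ExcludedMiddle using (ExcludedMiddle)
open import Axiom.Extensionality.Propositional using (Extensionality)
open import Data.Bool.Base using (Bool; true; false; if_then_else_)
open import Data.Bool.Properties using (if-float)
open import Data.List.Base using (List; []; _∷_; _++_)
open import Data.List.Membership.Propositional using (_∈_)
open import Data.List.Membership.Propositional.Properties using (∈-++⁺ˡ; ∈-++⁺ʳ)
open import Data.List.Relation.Unary.All as All using (All; []; _∷_)
open import Data.List.Relation.Unary.Any using (here; there)
open import Data.Nat.Base using (ℕ)
open import Data.Product.Base using (∃-syntax; _×_; _,_; proj₁; proj₂; map₁; map₂)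
open import Data.Sum.Base using (inj₁; inj₂)
open import Data.Unit.Base using (tt)
open import Data.Vec.Base as Vec using (Vec; []; _∷_)
import Data.Vec.Properties as Vec
open import Data.Vec.Relation.Unary.All as VAll using ([]; _∷_)
open import Function.Base using (_∘_; id)
open import Function.Bundles using (_⇔_; mk⇔; Equivalence)
open import Level using (0ℓ)
open import Relation.Binary.PropositionalEquality
  using (_≡_; _≢_; refl; sym; trans; cong; cong₂; subst; subst₂; module ≡-Reasoning)
open import Relation.Nullary using (Dec; yes; no; ⌊_⌋; contradiction)
open import Relation.Nullary.Decidable using (decidable-stable; recompute)
open import Defs

module ConvexCombinations (em : ExcludedMiddle 0ℓ) (ℝ : CompleteOrderedField) where
  open CompleteOrderedField ℝ
  open RealLemmas ℝ
  open Convexity ℝ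
  open RingProperties (CommutativeRing.ring commutativeRing) using (-‿distribʳ-*)
  open ≡-Reasoning

  private
    variable
      A B : Set
      m n : ℕ

  -- Arithmetic of weights in the unit interval.

  I-≡ : ∀ {p q : I} → value p ≡ value q → p ≡ q
  I-≡ {mk _ _ _} {mk _ _ _} refl = refl

  1-1≡0 : 1# - 1# ≡ 0#
  1-1≡0 = -‿inverseʳ 1#

  -- The bounds stored in `I` are irrelevant. Excluded middle decides the inequality, so `recompute`
  -- turns the irrelevant proof into a usable one.
  0≤value : ∀ p → 0# ≤ value p
  0≤value (mk p 0≤p _) = recompute em 0≤p

  value≤1 : ∀ p → value p ≤ 1#
  value≤1 (mk p _ p≤1) = recompute em p≤1

  0<1- : ∀ {p} → p <1 → 0< (1- p)
  0<1- {p@(mk _ _ _)} (_ , p≢1) = 0≤value (1- p) , (p≢1 ∘ 1-x≡0⇒x≡1 ∘ sym)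

  1-<1 : ∀ {p} → 0< p → (1- p) <1
  1-<1 {p@(mk x _ _)} (_ , 0≢p) =
    value≤1 (1- p) , λ 1-x≡1 → 0≢p (trans (sym 1-1≡0) (trans (cong (λ a → 1# - a) (sym 1-x≡1)) (1-[1-x] x)))

  0ᴵ : I
  0ᴵ = mk 0# ≤-refl 0≤1

  1-0≡1 : 1# - 0# ≡ 1#
  1-0≡1 = trans (sym (+-identityʳ (1# - 0#))) (x-y+y 1# 0#)

  1⁻¹≡1 : 1# ⁻¹ ≡ 1#
  1⁻¹≡1 = trans (sym (*-identityˡ (1# ⁻¹))) (inverse 1# (0≢1 ∘ sym))

  x*[y*x⁻¹] : ∀ {x} y → x ≢ 0# → x * (y * x ⁻¹) ≡ y
  x*[y*x⁻¹] {x} y x≢0 = begin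
    x * (y * x ⁻¹) ≡⟨ *-comm x (y * x ⁻¹) ⟩
    (y * x ⁻¹) * x ≡⟨ *-assoc y (x ⁻¹) x ⟩
    y * (x ⁻¹ * x) ≡⟨ cong (y *_) (trans (*-comm (x ⁻¹) x) (inverse x x≢0)) ⟩
    y * 1#         ≡⟨ *-identityʳ y ⟩
    y              ∎

  -- This is the mass left in a mixture with weight p once a head of weight q has been removed from
  -- its first component: 1 - q of that component, scaled by p, and all of the second, scaled by 1 -
  -- p.
  p[1-q]+[1-p] : ∀ p q → p * (1# - q) + (1# - p) ≡ 1# - p * q
  p[1-q]+[1-p] p q = begin
    p * (1# - q) + (1# - p)            ≡⟨ cong (_+ (1# - p)) (distribˡ p 1# (- q)) ⟩
    (p * 1# + p * - q) + (1# - p)      ≡⟨ +-comm _ _ ⟩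
    (1# - p) + (p * 1# + p * - q)      ≡⟨ cong₂ (λ a b → (1# - p) + (a + b)) (*-identityʳ p) (sym (-‿distribʳ-* p q)) ⟩
    (1# - p) + (p + - (p * q))         ≡⟨ +-assoc (1# - p) p (- (p * q)) ⟨
    ((1# - p) + p) + - (p * q)         ≡⟨ cong (_- p * q) (x-y+y 1# p) ⟩
    1# - p * q                         ∎

  x+y≡z⇒y≡z-x : ∀ {x y z} → x + y ≡ z → z - x ≡ y
  x+y≡z⇒y≡z-x {x} {y} refl = x+y-x x y

  -- Since y - xy = y(1 - x) is nonnegative, 1 = xy ≤ y ≤ 1.
  *-≡1⇒≡1 : ∀ {x y} → 0# ≤ y → x ≤ 1# → y ≤ 1# → x * y ≡ 1# → y ≡ 1#
  *-≡1⇒≡1 {x} {y} 0≤y x≤1 y≤1 xy≡1 = ≤-antisym y≤1 (subst (_≤ y) xy≡1 (0≤-⇒≤ 0≤y-xy))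
    where
    0≤y-xy : 0# ≤ y - x * y
    0≤y-xy = subst (0# ≤_) (begin
      y * (1# - x)      ≡⟨ distribˡ y 1# (- x) ⟩
      y * 1# + y * - x  ≡⟨ cong₂ _+_ (*-identityʳ y) (sym (-‿distribʳ-* y x)) ⟩
      y - y * x         ≡⟨ cong (λ a → y - a) (*-comm y x) ⟩
      y - x * y         ∎) (*-nonneg 0≤y (≤⇒0≤- x≤1))

  -- Rescaling and weightless terms of formal weighted sums.

  scale-scale : ∀ c d (v : Vec (Carrier × A) n) → scale c (scale d v) ≡ scale (c * d) v
  scale-scale c d v = trans (sym (Vec.map-∘ (map₁ (c *_)) (map₁ (d *_)) v))
    (Vec.map-cong (λ { (p , x) → cong (_, x) (sym (*-assoc c d p)) }) v)

  scale-1 : (v : Vec (Carrier × A) n) → scale 1# v ≡ v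
  scale-1 v = trans (Vec.map-cong (λ { (p , x) → cong (_, x) (*-identityˡ p) }) v) (Vec.map-id v)

  scale-++ : ∀ c (v : Vec (Carrier × A) m) (w : Vec (Carrier × A) n) →
             scale c (v Vec.++ w) ≡ scale c v Vec.++ scale c w
  scale-++ c = Vec.map-++ (map₁ (c *_))

  scale-map₂ : ∀ (f : A → B) c (v : Vec (Carrier × A) n) →
               scale c (Vec.map (map₂ f) v) ≡ Vec.map (map₂ f) (scale c v)
  scale-map₂ f c v = trans (sym (Vec.map-∘ (map₁ (c *_)) (map₂ f) v))
                           (Vec.map-∘ (map₂ f) (map₁ (c *_)) v)

  Weightless : Vec (Carrier × A) n → Set
  Weightless = VAll.All λ t → proj₁ t ≡ 0#

  weightless : {v : Vec (Carrier × A) n} → Nonneg v → totalWeight v ≡ 0# → Weightless v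
  weightless [] _ = []
  weightless {v = (p , x) ∷ v} (0≤p ∷ nn) t≡0 = p≡0 ∷ weightless nn (begin
    totalWeight v      ≡⟨ +-identityˡ (totalWeight v) ⟨
    0# + totalWeight v ≡⟨ cong (_+ totalWeight v) p≡0 ⟨
    p + totalWeight v  ≡⟨ t≡0 ⟩
    0#                 ∎)
    where
    p≡0 : p ≡ 0#
    p≡0 = ≤-antisym (subst (p ≤_) t≡0 (x≤x+y p (totalWeight-nonneg nn))) 0≤p

  scale-weightless : ∀ c {v : Vec (Carrier × A) n} → Weightless v → Weightless (scale c v)
  scale-weightless c []         = []
  scale-weightless c (refl ∷ z) = zeroʳ c ∷ scale-weightless c z

  -- Evaluation of formal convex combinations.

  module _ {X : Set} (_+[_]_ : X → I → X → X) where

    convexVec-≡1 : ∀ {p x} {v : Vec (Carrier × X) n} .{d : IsDistribution ((p , x) ∷ v)} →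
                   p ≡ 1# → convexVec em _+[_]_ ((p , x) ∷ v) d ≡ x
    convexVec-≡1 {p = p} p≡1 with em {p ≡ 1#}
    ... | yes _  = refl
    ... | no p≢1 = contradiction p≡1 p≢1

    -- The weight `q` and the tail `w` are free up to equations, so that a caller can supply them in
    -- a convenient form without transporting proofs of `IsDistribution`.
    convexVec-≢1 : ∀ {p x} {v w : Vec (Carrier × X) n}
                   .{d : IsDistribution ((p , x) ∷ v)} .{e : IsDistribution w} →
                   p ≢ 1# → (q : I) → value q ≡ p → normalise p v ≡ w →
                   convexVec em _+[_]_ ((p , x) ∷ v) d ≡ (x +[ q ] convexVec em _+[_]_ w e)
    convexVec-≢1 {p = p} p≢1 (mk _ _ _) refl refl with em {p ≡ 1#}
    ... | yes p≡1 = contradiction p≡1 p≢1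
    ... | no _    = refl

  -- Induction on the length, as the tail is rescaled at each step. The image `w` is given up to an
  -- equation because rescaling and relabelling commute only propositionally, by `scale-map₂`.
  convexVec-map : {X Y : Set} {_+[_]_ : X → I → X → X} {_⊕[_]_ : Y → I → Y → Y} (h : X → Y) →
                  (∀ p x y → h (x +[ p ] y) ≡ (h x ⊕[ p ] h y)) →
                  (v : Vec (Carrier × X) n) (d : IsDistribution v)
                  {w : Vec (Carrier × Y) n} .{e : IsDistribution w} → Vec.map (map₂ h) v ≡ w →
                  h (convexVec em _+[_]_ v d) ≡ convexVec em _⊕[_]_ w e
  convexVec-map h hom [] d refl = contradiction (IsDistribution.total1 d) 0≢1
  convexVec-map {_+[_]_ = _+[_]_} {_⊕[_]_} h hom ((p , x) ∷ v) d refl with em {p ≡ 1#}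
  ... | yes _  = refl
  ... | no p≢1 = trans (hom _ x _)
    (cong (h x ⊕[ mk p (head-nonneg d) (head-≤1 d) ]_)
      (convexVec-map h hom (normalise p v) (isDistribution-normalise p≢1 d)
        (sym (scale-map₂ h _ v))))

  dist-≡ : {v w : Vec (Carrier × A) n} .{d : IsDistribution v} .{e : IsDistribution w} →
           v ≡ w → dist v d ≡ dist w e
  dist-≡ refl = refl

  mapDist-∘ : {C : Set} (g : B → C) (f : A → B) (D : Dist A) → mapDist g (mapDist f D) ≡ mapDist (g ∘ f) D
  mapDist-∘ g f (dist v d) = dist-≡ (sym (Vec.map-∘ (map₂ g) (map₂ f) v))

  mapDist-cong : {f g : A → B} → (∀ x → f x ≡ g x) → (D : Dist A) → mapDist f D ≡ mapDist g D
  mapDist-cong f≗g (dist v d) = dist-≡ (Vec.map-cong (λ { (p , x) → cong (p ,_) (f≗g x) }) v)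

  mapDist-mix : (f : A → B) (p : I) (D E : Dist A) →
                mapDist f (mixDist p D E) ≡ mixDist p (mapDist f D) (mapDist f E)
  mapDist-mix f (mk p _ _) (dist v d) (dist w e) = dist-≡
    (trans (Vec.map-++ (map₂ f) (scale p v) (scale (1# - p) w))
           (cong₂ Vec._++_ (sym (scale-map₂ f p v)) (sym (scale-map₂ f (1# - p) w))))

  convex-map : {X Y : Set} {_+[_]_ : X → I → X → X} {_⊕[_]_ : Y → I → Y → Y} (h : X → Y) →
               (∀ p x y → h (x +[ p ] y) ≡ (h x ⊕[ p ] h y)) →
               (D : Dist X) → h (convex em _+[_]_ D) ≡ convex em _⊕[_]_ (mapDist h D)
  convex-map h hom (dist v d) = convexVec-map h hom v (recompute em d) refl

  module _ {X : Set} {_+[_]_ : X → I → X → X} (bary : IsBarycentricAlgebra _+[_]_) where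
    open IsBarycentricAlgebra bary using (skew; assoc) renaming (unit to mix-1)

    mix-≡1 : ∀ p x y → value p ≡ 1# → (x +[ p ] y) ≡ x
    mix-≡1 p x y p≡1 = trans (cong (x +[_] y) (I-≡ p≡1)) (mix-1 x y)

    mix-≡0 : ∀ p x y → value p ≡ 0# → (x +[ p ] y) ≡ y
    mix-≡0 (mk p _ _) x y p≡0 =
      trans (skew _ x y) (mix-≡1 _ y x (trans (cong (λ a → 1# - a) p≡0) 1-0≡1))

    -- A head of weight 0 disappears by `mix-≡0`, and the renormalisation of what follows divides by
    -- 1 - 0 = 1.
    convexVec-weightless : ∀ {z : Vec (Carrier × X) m} (w : Vec (Carrier × X) n)
                           {u : Vec (Carrier × X) _} .{d : IsDistribution w} .{e : IsDistribution u} →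
                           Weightless z → u ≡ z Vec.++ w →
                           convexVec em _+[_]_ u e ≡ convexVec em _+[_]_ w d
    convexVec-weightless w [] refl = refl
    convexVec-weightless {z = (_ , x) ∷ z} w {d = d} {e} (refl ∷ zs) refl = begin
      convexVec em _+[_]_ ((0# , x) ∷ (z Vec.++ w)) e
        ≡⟨ convexVec-≢1 _+[_]_ 0≢1 0ᴵ refl refl ⟩
      (x +[ 0ᴵ ] convexVec em _+[_]_ (normalise 0# (z Vec.++ w)) e′)
        ≡⟨ mix-≡0 0ᴵ x _ refl ⟩
      convexVec em _+[_]_ (normalise 0# (z Vec.++ w)) e′
        ≡⟨ convexVec-weightless w {d = d} zs (begin
             normalise 0# (z Vec.++ w) ≡⟨ cong (λ c → scale c (z Vec.++ w)) (trans (cong _⁻¹ 1-0≡1) 1⁻¹≡1) ⟩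
             scale 1# (z Vec.++ w)     ≡⟨ scale-1 (z Vec.++ w) ⟩
             z Vec.++ w                ∎) ⟩
      convexVec em _+[_]_ w d ∎
      where
      e′ : IsDistribution (normalise 0# (z Vec.++ w))
      e′ = recompute em (isDistribution-normalise {x = x} 0≢1 e)

    -- Induction on the first vector, whose head `x` of weight q weighs pq in the mixture.
    -- Evaluation tests pq against 1 on the left and q against 1 on the right. This leaves three
    -- cases: pq = 1, only q = 1, and neither; the last rests on associativity.
    convexVec-mix : ∀ (p : I) (v : Vec (Carrier × X) m) (w : Vec (Carrier × X) n)
                    (d : IsDistribution v) (e : IsDistribution w)
                    {u : Vec (Carrier × X) _} .{c : IsDistribution u} →
                    scale (value p) v Vec.++ scale (1# - value p) w ≡ u →
                    convexVec em _+[_]_ u c ≡ (convexVec em _+[_]_ v d +[ p ] convexVec em _+[_]_ w e)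
    convexVec-mix p [] w d e refl = contradiction (IsDistribution.total1 d) 0≢1
    convexVec-mix P@(mk p 0≤p p≤1) ((q , x) ∷ v) w d e {c = c} refl = go em em
      where
      W : X
      W = convexVec em _+[_]_ w e

      Q : I
      Q = mk q (head-nonneg d) (head-≤1 d)

      rest : Vec (Carrier × X) _
      rest = scale p v Vec.++ scale (1# - p) w

      Goal : Set
      Goal = convexVec em _+[_]_ ((p * q , x) ∷ rest) c ≡ (convexVec em _+[_]_ ((q , x) ∷ v) d +[ P ] W)

      0≤p′ : 0# ≤ p
      0≤p′ = 0≤value P
      p≤1′ : p ≤ 1#
      p≤1′ = value≤1 P

      head-one : p * q ≡ 1# → Goal
      head-one pq≡1 = begin
        convexVec em _+[_]_ ((p * q , x) ∷ rest) c ≡⟨ convexVec-≡1 _+[_]_ pq≡1 ⟩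
        x                                          ≡⟨ mix-≡1 P x W p≡1 ⟨
        (x +[ P ] W)                               ≡⟨ cong (_+[ P ] W) (convexVec-≡1 _+[_]_ q≡1) ⟨
        (convexVec em _+[_]_ ((q , x) ∷ v) d +[ P ] W) ∎
        where
        q≡1 : q ≡ 1#
        q≡1 = *-≡1⇒≡1 (head-nonneg d) p≤1′ (head-≤1 d) pq≡1
        p≡1 : p ≡ 1#
        p≡1 = *-≡1⇒≡1 0≤p′ (head-≤1 d) p≤1′ (trans (*-comm q p) pq≡1)

      -- With q = 1 the other terms of `v` weigh nothing, and pq = p. The tail of the mixture,
      -- rescaled by 1/(1 - p), is therefore `w` preceded by weightless terms.
      second-one : p * q ≢ 1# → q ≡ 1# → Goal
      second-one pq≢1 q≡1 = begin
        convexVec em _+[_]_ ((p * q , x) ∷ rest) c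
          ≡⟨ convexVec-≢1 _+[_]_ {e = isDistribution-normalise pq≢1 c} pq≢1 P (sym pq≡p) refl ⟩
        (x +[ P ] convexVec em _+[_]_ (normalise (p * q) rest) _)
          ≡⟨ cong (x +[ P ]_) (convexVec-weightless w (scale-weightless _ (scale-weightless p zeros)) tail≡) ⟩
        (x +[ P ] W) ≡⟨ cong (_+[ P ] W) (convexVec-≡1 _+[_]_ q≡1) ⟨
        (convexVec em _+[_]_ ((q , x) ∷ v) d +[ P ] W) ∎
        where
        pq≡p : p * q ≡ p
        pq≡p = trans (cong (p *_) q≡1) (*-identityʳ p)
        zeros : Weightless v
        zeros = weightless (VAll.tail (IsDistribution.nonneg d)) (begin
          totalWeight v ≡⟨ x+y≡z⇒y≡z-x (IsDistribution.total1 d) ⟨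
          1# - q        ≡⟨ cong (λ a → 1# - a) q≡1 ⟩
          1# - 1#       ≡⟨ 1-1≡0 ⟩
          0#            ∎)
        k : Carrier
        k = (1# - p * q) ⁻¹
        tail≡ : normalise (p * q) rest ≡ scale k (scale p v) Vec.++ w
        tail≡ = trans (scale-++ k (scale p v) (scale (1# - p) w)) (cong (scale k (scale p v) Vec.++_) (begin
          scale k (scale (1# - p) w)      ≡⟨ scale-scale k (1# - p) w ⟩
          scale (k * (1# - p)) w          ≡⟨ cong (λ a → scale (k * (1# - a)) w) pq≡p ⟨
          scale (k * (1# - p * q)) w      ≡⟨ cong (λ a → scale a w) (trans (*-comm k _) (inverse _ (pq≢1 ∘ 1-x≡0⇒x≡1))) ⟩
          scale 1# w                      ≡⟨ scale-1 w ⟩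
          w                               ∎))

      neither-one : p * q ≢ 1# → q ≢ 1# → Goal
      neither-one pq≢1 q≢1 = begin
        convexVec em _+[_]_ ((p * q , x) ∷ rest) c
          ≡⟨ convexVec-≢1 _+[_]_ {e = isDistribution-normalise pq≢1 c} pq≢1 (Q *ᴵ P) (*-comm q p) refl ⟩
        (x +[ Q *ᴵ P ] convexVec em _+[_]_ (normalise (p * q) rest) _)
          ≡⟨ cong (x +[ Q *ᴵ P ]_) (convexVec-mix s (normalise q v) w d′ e (sym tail≡)) ⟩
        (x +[ Q *ᴵ P ] (V +[ s ] W))
          ≡⟨ reassociate em ⟩
        ((x +[ Q ] V) +[ P ] W)
          ≡⟨ cong (_+[ P ] W) (convexVec-≢1 _+[_]_ q≢1 Q refl refl) ⟨
        (convexVec em _+[_]_ ((q , x) ∷ v) d +[ P ] W) ∎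
        where
        d′ : IsDistribution (normalise q v)
        d′ = isDistribution-normalise q≢1 d
        V : X
        V = convexVec em _+[_]_ (normalise q v) d′
        D k : Carrier
        D = 1# - p * q
        k = D ⁻¹
        D≢0 : D ≢ 0#
        D≢0 = pq≢1 ∘ 1-x≡0⇒x≡1
        0≤k : 0# ≤ k
        0≤k = ⁻¹-nonneg (≤⇒0≤- (*-≤1 0≤p′ p≤1′ (head-≤1 d))) D≢0
        -- The two numbers k p(1 - q) and k(1 - p) are the shares of the rest of `v` and of `w` in
        -- the rescaled tail, so they add up to 1.
        1-s : 1# - k * (p * (1# - q)) ≡ k * (1# - p)
        1-s = x+y≡z⇒y≡z-x (begin
          k * (p * (1# - q)) + k * (1# - p) ≡⟨ distribˡ k _ _ ⟨
          k * (p * (1# - q) + (1# - p))     ≡⟨ cong (k *_) (p[1-q]+[1-p] p q) ⟩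
          k * D                             ≡⟨ *-comm k D ⟩
          D * k                             ≡⟨ inverse D D≢0 ⟩
          1#                                ∎)
        -- s = p(1-q)/(1-pq), the weight that rebalances x +[ q ] V against W in assoc.
        s : I
        s = mk (k * (p * (1# - q)))
               (*-nonneg 0≤k (*-nonneg 0≤p′ (≤⇒0≤- (head-≤1 d))))
               (0≤-⇒≤ (subst (0# ≤_) (sym 1-s) (*-nonneg 0≤k (≤⇒0≤- p≤1′))))
        tail≡ : normalise (p * q) rest ≡ scale (value s) (normalise q v) Vec.++ scale (1# - value s) w
        tail≡ = trans (scale-++ k (scale p v) (scale (1# - p) w)) (cong₂ Vec._++_
          (begin
            scale k (scale p v)                     ≡⟨ scale-scale k p v ⟩
            scale (k * p) v                         ≡⟨ cong (λ a → scale a v) (begin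
              k * p                                   ≡⟨ cong (k *_) (x*[y*x⁻¹] p (q≢1 ∘ 1-x≡0⇒x≡1)) ⟨
              k * ((1# - q) * (p * (1# - q) ⁻¹))      ≡⟨ cong (k *_) (*-assoc (1# - q) p _) ⟨
              k * ((1# - q) * p * (1# - q) ⁻¹)        ≡⟨ *-assoc k _ _ ⟨
              k * ((1# - q) * p) * (1# - q) ⁻¹        ≡⟨ cong (λ a → k * a * (1# - q) ⁻¹) (*-comm (1# - q) p) ⟩
              value s * (1# - q) ⁻¹                   ∎) ⟩
            scale (value s * (1# - q) ⁻¹) v         ≡⟨ scale-scale (value s) _ v ⟨
            scale (value s) (normalise q v)         ∎)
          (trans (scale-scale k (1# - p) w) (cong (λ a → scale a w) (sym 1-s))))
        -- The side condition of `assoc` with `Q` as inner and `P` as outer weight.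
        s-eq : value s * (1# - q * p) ≡ (1# - q) * p
        s-eq = begin
          k * (p * (1# - q)) * (1# - q * p)  ≡⟨ cong₂ (λ a b → k * a * (1# - b)) (*-comm p (1# - q)) (*-comm q p) ⟩
          k * ((1# - q) * p) * D             ≡⟨ *-comm _ D ⟩
          D * (k * ((1# - q) * p))           ≡⟨ cong (D *_) (*-comm k _) ⟩
          D * ((1# - q) * p * k)             ≡⟨ x*[y*x⁻¹] _ D≢0 ⟩
          (1# - q) * p                       ∎
        -- `assoc` asks for both weights to be below 1. At p = 1 it does not apply, but then s = 1
        -- and both sides reduce to `x +[ Q ] V`.
        reassociate : Dec (p ≡ 1#) → (x +[ Q *ᴵ P ] (V +[ s ] W)) ≡ ((x +[ Q ] V) +[ P ] W)
        reassociate (no p≢1)  = sym (assoc Q P s (head-≤1 d , q≢1) (p≤1′ , p≢1) s-eq x V W)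
        reassociate (yes p≡1) = begin
          (x +[ Q *ᴵ P ] (V +[ s ] W)) ≡⟨ cong₂ (x +[_]_) (I-≡ (trans (cong (q *_) p≡1) (*-identityʳ q))) (mix-≡1 s V W s≡1) ⟩
          (x +[ Q ] V)                 ≡⟨ mix-≡1 P (x +[ Q ] V) W p≡1 ⟨
          ((x +[ Q ] V) +[ P ] W)      ∎
          where
          s≡1 : value s ≡ 1#
          s≡1 = 1-x≡0⇒x≡1 (begin
            1# - value s    ≡⟨ 1-s ⟩
            k * (1# - p)    ≡⟨ cong (λ a → k * (1# - a)) p≡1 ⟩
            k * (1# - 1#)   ≡⟨ cong (k *_) 1-1≡0 ⟩
            k * 0#          ≡⟨ zeroʳ k ⟩
            0#              ∎)

      go : Dec (p * q ≡ 1#) → Dec (q ≡ 1#) → Goal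
      go (yes pq≡1) _         = head-one pq≡1
      go (no pq≢1)  (yes q≡1) = second-one pq≢1 q≡1
      go (no pq≢1)  (no q≢1)  = neither-one pq≢1 q≢1

    convex-mix : ∀ p (D E : Dist X) →
                 convex em _+[_]_ (mixDist p D E) ≡ (convex em _+[_]_ D +[ p ] convex em _+[_]_ E)
    convex-mix p (dist v d) (dist w e) = convexVec-mix p v w (recompute em d) (recompute em e) refl

    convex-dirac : ∀ x → convex em _+[_]_ (dirac x) ≡ x
    convex-dirac x = convexVec-≡1 _+[_]_ refl

module FullAbstraction
  (em : ExcludedMiddle 0ℓ)
  (ext : Extensionality 0ℓ 0ℓ)
  (ℝ  : CompleteOrderedField)
  (𝓡  : Structures.RewardAlgebra ℝ)
  (Sg : Structures.Signature ℝ)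
  (𝓘  : Structures.Interpretation ℝ 𝓡 Sg)
  (𝓣  : Structures.AuxiliaryMonad ℝ 𝓡)
  where

  open Convexity ℝ
  open ConvexCombinations em ℝ
  open Structures ℝ
  open Syntax ℝ Sg renaming (ext to extʳ)
  open Signature Sg
  open Interpretation 𝓘
  open Semantics em ℝ 𝓡 Sg 𝓘 𝓣
  private
    module R = RewardAlgebra 𝓡
    module T = AuxiliaryMonad 𝓣
    module ℝ = CompleteOrderedField ℝ
    module TM {X : Set} = IsBarycentricModule (T.isBarycentricModule {X})
  open R using (R)
  open T using (T)
  open ≡-Reasoning

  private
    variable
      X Y Z′ : Set
      Γ Δ    : Cx
      σ τ    : Ty
      b      : Base
      bs     : List Base

  -- Laws of the selection monad and algebraicity of its operations.

  †-cong : {f g : X → T Y} → (∀ x → f x ≡ g x) → ∀ u → (f T.†) u ≡ (g T.†) u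
  †-cong f≗g u = cong (λ f → (f T.†) u) (ext f≗g)

  map-∘-† : (γ : Y → Z′) (f : X → T Y) (u : T X) → T.map γ ((f T.†) u) ≡ ((T.map γ ∘ f) T.†) u
  map-∘-† γ f u = T.†-assoc (T.η ∘ γ) f u

  †-∘-map : (f : Y → T Z′) (γ : X → Y) (u : T X) → (f T.†) (T.map γ u) ≡ ((f ∘ γ) T.†) u
  †-∘-map f γ u = trans (T.†-assoc f (T.η ∘ γ) u) (†-cong (λ x → T.†-identityˡ f (γ x)) u)

  -- `f †` is `join` after `map f`, so this is the multiplication law of the algebra `α`.
  α-† : (f : X → T R) (u : T X) → T.α (T.map (T.α ∘ f) u) ≡ T.α ((f T.†) u)
  α-† f u = begin
    T.α (T.map (T.α ∘ f) u)       ≡⟨ cong T.α (†-∘-map (T.η ∘ T.α) f u) ⟨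
    T.α (T.map T.α (T.map f u))   ≡⟨ T.α-join (T.map f u) ⟩
    T.α (T.join (T.map f u))      ≡⟨ cong T.α (†-∘-map id f u) ⟩
    T.α ((f T.†) u)               ∎

  -- The continuation x ↦ 𝐑(f x | γ) in the definition of `†ˢ` is exactly the one under which `F`
  -- earns the reward of the whole sequence. Associativity of `†ˢ` and its compatibility with `orˢ`
  -- both come from this.
  𝐑-† : (f : X → S̲ Y) (F : S̲ X) (γ : Y → R) → 𝐑 ((f †ˢ) F) γ ≡ 𝐑 F (λ x → 𝐑 (f x) γ)
  𝐑-† f F γ = trans (cong T.α (map-∘-† γ (λ x → f x γ) _)) (sym (α-† (λ x → T.map γ (f x γ)) _))

  †ˢ-identityˡ : (f : X → S̲ Y) (x : X) → (f †ˢ) (ηˢ x) ≡ f x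
  †ˢ-identityˡ f x = ext λ γ → T.†-identityˡ (λ x → f x γ) x

  𝐑-η : (x : X) (γ : X → R) → 𝐑 (ηˢ x) γ ≡ γ x
  𝐑-η x γ = trans (cong T.α (T.†-identityˡ (T.η ∘ γ) x)) (T.α-η (γ x))

  †ˢ-identityʳ : (F : S̲ X) → (ηˢ †ˢ) F ≡ F
  †ˢ-identityʳ F = ext λ γ → trans (T.†-identityʳ _) (cong F (ext λ x → 𝐑-η x γ))

  †ˢ-assoc : (g : Y → S̲ Z′) (f : X → S̲ Y) (F : S̲ X) → (g †ˢ) ((f †ˢ) F) ≡ ((λ x → (g †ˢ) (f x)) †ˢ) F
  †ˢ-assoc g f F = ext λ γ → trans (T.†-assoc (λ y → g y γ) _ _)
    (cong (λ δ → ((λ x → (g †ˢ) (f x) γ) T.†) (F δ)) (ext λ x → sym (𝐑-† g (f x) γ)))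

  -- By `𝐑-†`, comparing the two extended computations under `γ` is the same test as comparing `F`
  -- and `G` under `γ′ γ`, so the same branch is chosen before and after extension.
  †ˢ-or : (f : X → S̲ Y) (F G : S̲ X) → (f †ˢ) (F orˢ G) ≡ (f †ˢ) F orˢ (f †ˢ) G
  †ˢ-or f F G = ext λ γ → begin
    ((λ x → f x γ) T.†) ((F orˢ G) (γ′ γ))
      ≡⟨ if-float ((λ x → f x γ) T.†) ⌊ em {𝐑 G (γ′ γ) R.≤ 𝐑 F (γ′ γ)} ⌋ ⟩
    (if ⌊ em {𝐑 G (γ′ γ) R.≤ 𝐑 F (γ′ γ)} ⌋ then (f †ˢ) F γ else (f †ˢ) G γ)
      ≡⟨ cong₂ (λ r s → if ⌊ em {r R.≤ s} ⌋ then (f †ˢ) F γ else (f †ˢ) G γ) (𝐑-† f G γ) (𝐑-† f F γ) ⟨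
    ((f †ˢ) F orˢ (f †ˢ) G) γ ∎
    where
    γ′ : _ → _ → R
    γ′ γ x = 𝐑 (f x) γ

  †ˢ-· : (f : X → S̲ Y) (r : R) (F : S̲ X) → (f †ˢ) (r ·ˢ F) ≡ r ·ˢ (f †ˢ) F
  †ˢ-· f r F = ext λ γ → T.·-algebraic _ r _

  †ˢ-mix : (f : X → S̲ Y) (p : I) (F G : S̲ X) → (f †ˢ) (F +ˢ[ p ] G) ≡ ((f †ˢ) F +ˢ[ p ] (f †ˢ) G)
  †ˢ-mix f p F G = ext λ γ → T.mix-algebraic _ p _ _

  cong-†ˢ : {f g : X → S̲ Y} {F G : S̲ X} → (∀ x → f x ≡ g x) → F ≡ G → (f †ˢ) F ≡ (g †ˢ) G
  cong-†ˢ {F = F} f≗g refl = cong (λ f → (f †ˢ) F) (ext f≗g)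

  -- Soundness of evaluation

  𝒮-rename     : (θ : Ren Γ Δ) {ρ : 𝒮⟦ Γ ⟧ᶜ} {ρ′ : 𝒮⟦ Δ ⟧ᶜ} →
                 (∀ {τ} (x : Γ ∋ τ) → lookup ρ′ (θ x) ≡ lookup ρ x) →
                 (M : Term Γ σ) → 𝒮⟦ rename θ M ⟧ ρ′ ≡ 𝒮⟦ M ⟧ ρ
  𝒮-renameArgs : (θ : Ren Γ Δ) {ρ : 𝒮⟦ Γ ⟧ᶜ} {ρ′ : 𝒮⟦ Δ ⟧ᶜ} →
                 (∀ {τ} (x : Γ ∋ τ) → lookup ρ′ (θ x) ≡ lookup ρ x) →
                 (Ms : Args Γ bs) → 𝒮⟦ renameArgs θ Ms ⟧args ρ′ ≡ 𝒮⟦ Ms ⟧args ρ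

  𝒮-rename θ h (var x)      = cong ηˢ (h x)
  𝒮-rename θ h (con c)      = refl
  𝒮-rename θ h (fun f Ms)   = cong (_ †ˢ) (𝒮-renameArgs θ h Ms)
  𝒮-rename θ h (if L M N)   = cong-†ˢ
    (λ t → cong₂ (λ F G → if t then F else G) (𝒮-rename θ h M) (𝒮-rename θ h N)) (𝒮-rename θ h L)
  𝒮-rename θ h (M or N)     = cong₂ _orˢ_ (𝒮-rename θ h M) (𝒮-rename θ h N)
  𝒮-rename θ h (N · M)      = cong-†ˢ (λ r → cong (r ·ˢ_) (𝒮-rename θ h M)) (𝒮-rename θ h N)
  𝒮-rename θ h (M +[ p ] N) = cong₂ _+ˢ[ p ]_ (𝒮-rename θ h M) (𝒮-rename θ h N)
  𝒮-rename θ h ∗            = refl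
  𝒮-rename θ h ⟨ M , N ⟩    = cong-†ˢ (λ a → cong (_ †ˢ) (𝒮-rename θ h N)) (𝒮-rename θ h M)
  𝒮-rename θ h (fst M)      = cong (_ †ˢ) (𝒮-rename θ h M)
  𝒮-rename θ h (snd M)      = cong (_ †ˢ) (𝒮-rename θ h M)
  𝒮-rename θ h (ƛ M)        =
    cong ηˢ (ext λ a → 𝒮-rename (extʳ θ) (λ { Z → refl ; (S x) → h x }) M)
  𝒮-rename θ h (app M N)    = cong-†ˢ (λ f → cong (f †ˢ) (𝒮-rename θ h N)) (𝒮-rename θ h M)

  𝒮-renameArgs θ h []       = refl
  𝒮-renameArgs θ h (M ∷ Ms) = cong-†ˢ (λ a → cong (_ †ˢ) (𝒮-renameArgs θ h Ms)) (𝒮-rename θ h M)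

  -- A variable denotes a unit under call-by-value, so only terms that denote units may replace it.
  -- Under a binder, `𝒮-rename` carries this condition over to the weakened terms.
  𝒮-substitute     : (θ : Sub Γ Δ) {ρ : 𝒮⟦ Γ ⟧ᶜ} {ρ′ : 𝒮⟦ Δ ⟧ᶜ} →
                     (∀ {τ} (x : Γ ∋ τ) → 𝒮⟦ θ x ⟧ ρ′ ≡ ηˢ (lookup ρ x)) →
                     (M : Term Γ σ) → 𝒮⟦ substitute θ M ⟧ ρ′ ≡ 𝒮⟦ M ⟧ ρ
  𝒮-substituteArgs : (θ : Sub Γ Δ) {ρ : 𝒮⟦ Γ ⟧ᶜ} {ρ′ : 𝒮⟦ Δ ⟧ᶜ} →
                     (∀ {τ} (x : Γ ∋ τ) → 𝒮⟦ θ x ⟧ ρ′ ≡ ηˢ (lookup ρ x)) →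
                     (Ms : Args Γ bs) → 𝒮⟦ substituteArgs θ Ms ⟧args ρ′ ≡ 𝒮⟦ Ms ⟧args ρ

  𝒮-substitute θ h (var x)      = h x
  𝒮-substitute θ h (con c)      = refl
  𝒮-substitute θ h (fun f Ms)   = cong (_ †ˢ) (𝒮-substituteArgs θ h Ms)
  𝒮-substitute θ h (if L M N)   = cong-†ˢ
    (λ t → cong₂ (λ F G → if t then F else G) (𝒮-substitute θ h M) (𝒮-substitute θ h N)) (𝒮-substitute θ h L)
  𝒮-substitute θ h (M or N)     = cong₂ _orˢ_ (𝒮-substitute θ h M) (𝒮-substitute θ h N)
  𝒮-substitute θ h (N · M)      = cong-†ˢ (λ r → cong (r ·ˢ_) (𝒮-substitute θ h M)) (𝒮-substitute θ h N)
  𝒮-substitute θ h (M +[ p ] N) = cong₂ _+ˢ[ p ]_ (𝒮-substitute θ h M) (𝒮-substitute θ h N)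
  𝒮-substitute θ h ∗            = refl
  𝒮-substitute θ h ⟨ M , N ⟩    = cong-†ˢ (λ a → cong (_ †ˢ) (𝒮-substitute θ h N)) (𝒮-substitute θ h M)
  𝒮-substitute θ h (fst M)      = cong (_ †ˢ) (𝒮-substitute θ h M)
  𝒮-substitute θ h (snd M)      = cong (_ †ˢ) (𝒮-substitute θ h M)
  𝒮-substitute θ {ρ} {ρ′} h (ƛ M) = cong ηˢ (ext λ a → 𝒮-substitute (exts θ)
    (λ { Z → refl ; (S x) → trans (𝒮-rename S (λ _ → refl) (θ x)) (h x) }) M)
  𝒮-substitute θ h (app M N)    = cong-†ˢ (λ f → cong (f †ˢ) (𝒮-substitute θ h N)) (𝒮-substitute θ h M)

  𝒮-substituteArgs θ h []       = refl
  𝒮-substituteArgs θ h (M ∷ Ms) = cong-†ˢ (λ a → cong (_ †ˢ) (𝒮-substituteArgs θ h Ms)) (𝒮-substitute θ h M)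

  ⟦_⟧val : Val σ → 𝒮⟦ σ ⟧ᵗ
  ⟦ con c ⟧val     = ⟦ c ⟧con
  ⟦ ∗ ⟧val         = tt
  ⟦ ⟨ V , W ⟩ ⟧val = ⟦ V ⟧val , ⟦ W ⟧val
  ⟦ ƛ M ⟧val       = λ a → 𝒮⟦ M ⟧ (a ∷ [])

  𝒮-value : (V : Val σ) → 𝒮⟦ ⌜ V ⌝ ⟧ [] ≡ ηˢ ⟦ V ⟧val
  𝒮-value (con c)   = refl
  𝒮-value ∗         = refl
  𝒮-value ⟨ V , W ⟩ = begin
    ((λ a → ((λ b → ηˢ (a , b)) †ˢ) (𝒮⟦ ⌜ W ⌝ ⟧ [])) †ˢ) (𝒮⟦ ⌜ V ⌝ ⟧ [])
      ≡⟨ cong-†ˢ (λ a → trans (cong (_ †ˢ) (𝒮-value W)) (†ˢ-identityˡ _ ⟦ W ⟧val)) (𝒮-value V) ⟩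
    ((λ a → ηˢ (a , ⟦ W ⟧val)) †ˢ) (ηˢ ⟦ V ⟧val)
      ≡⟨ †ˢ-identityˡ _ ⟦ V ⟧val ⟩
    ηˢ (⟦ V ⟧val , ⟦ W ⟧val) ∎
  𝒮-value (ƛ M)     = refl

  𝒮-constants : (cs : All Con bs) → 𝒮⟦ All.map con cs ⟧args [] ≡ ηˢ (All.map ⟦_⟧con cs)
  𝒮-constants []       = refl
  𝒮-constants (c ∷ cs) = trans (†ˢ-identityˡ _ ⟦ c ⟧con)
    (trans (cong (_ †ˢ) (𝒮-constants cs)) (†ˢ-identityˡ _ (All.map ⟦_⟧con cs)))

  𝒮-reduction : {Q Q′ : Program σ} → Q ⟶ᵣ Q′ → 𝒮⟦ Q ⟧ [] ≡ 𝒮⟦ Q′ ⟧ []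
  𝒮-reduction (fun f cs)        = trans (cong (_ †ˢ) (𝒮-constants cs))
    (trans (†ˢ-identityˡ _ (All.map ⟦_⟧con cs)) (cong ηˢ (⟦val⟧ f cs)))
  𝒮-reduction (if-tt {M = M} {N}) = trans (†ˢ-identityˡ _ ⟦ ttᶜ ⟧con)
    (cong (λ t → if t then 𝒮⟦ M ⟧ [] else 𝒮⟦ N ⟧ []) ⟦tt⟧)
  𝒮-reduction (if-ff {M = M} {N}) = trans (†ˢ-identityˡ _ ⟦ ffᶜ ⟧con)
    (cong (λ t → if t then 𝒮⟦ M ⟧ [] else 𝒮⟦ N ⟧ []) ⟦ff⟧)
  𝒮-reduction (fst V W) = trans (cong (_ †ˢ) (𝒮-value ⟨ V , W ⟩))
    (trans (†ˢ-identityˡ _ (⟦ V ⟧val , ⟦ W ⟧val)) (sym (𝒮-value V)))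
  𝒮-reduction (snd V W) = trans (cong (_ †ˢ) (𝒮-value ⟨ V , W ⟩))
    (trans (†ˢ-identityˡ _ (⟦ V ⟧val , ⟦ W ⟧val)) (sym (𝒮-value W)))
  𝒮-reduction (β M V) = begin
    𝒮⟦ app (ƛ M) ⌜ V ⌝ ⟧ []         ≡⟨ †ˢ-identityˡ _ (λ a → 𝒮⟦ M ⟧ (a ∷ [])) ⟩
    ((λ a → 𝒮⟦ M ⟧ (a ∷ [])) †ˢ) (𝒮⟦ ⌜ V ⌝ ⟧ []) ≡⟨ cong (_ †ˢ) (𝒮-value V) ⟩
    ((λ a → 𝒮⟦ M ⟧ (a ∷ [])) †ˢ) (ηˢ ⟦ V ⟧val)   ≡⟨ †ˢ-identityˡ _ ⟦ V ⟧val ⟩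
    𝒮⟦ M ⟧ (⟦ V ⟧val ∷ [])          ≡⟨ 𝒮-substitute (var ,ₛ ⌜ V ⌝) (λ { Z → 𝒮-value V }) M ⟨
    𝒮⟦ M [ ⌜ V ⌝ ] ⟧ []             ∎

  -- The program in the hole is run first, and everything around it is a fixed continuation `k`.
  -- Strictness is stated for any `H`, not just for evaluation contexts, so that it can be built up
  -- one frame at a time.
  Strict : (Program σ → S̲ X) → Set
  Strict {σ = σ} {X = X} H = ∃[ k ] (∀ (Q : Program σ) → H Q ≡ (k †ˢ) (𝒮⟦ Q ⟧ []))

  strict-† : {H : Program σ → S̲ X} (h : X → S̲ Y) → Strict H → Strict ((h †ˢ) ∘ H)
  strict-† h (k , k-eq) =
    (λ x → (h †ˢ) (k x)) , λ Q → trans (cong (h †ˢ) (k-eq Q)) (†ˢ-assoc h k (𝒮⟦ Q ⟧ []))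

  strict-≡ : {H H′ : Program σ → S̲ X} → (∀ Q → H′ Q ≡ H Q) → Strict H → Strict H′
  strict-≡ h (k , k-eq) = k , λ Q → trans (h Q) (k-eq Q)

  evalContext-strict     : (K : EvalContext σ τ) → Strict (λ Q → 𝒮⟦ K ⟪ Q ⟫ ⟧ [])
  argsEvalContext-strict : (A : ArgsEvalContext σ bs) → Strict (λ Q → 𝒮⟦ A ⟪ Q ⟫ᵃ ⟧args [])

  evalContext-strict □           = ηˢ , λ Q → sym (†ˢ-identityʳ (𝒮⟦ Q ⟧ []))
  evalContext-strict (fun f A)   = strict-† _ (argsEvalContext-strict A)
  evalContext-strict (if K M N)  = strict-† _ (evalContext-strict K)
  evalContext-strict (K · M)     = strict-† _ (evalContext-strict K)
  evalContext-strict (pair₁ K N) = strict-† _ (evalContext-strict K)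
  -- The value to the left of the hole denotes a unit, so its own Kleisli extension vanishes and the
  -- hole comes first after all.
  evalContext-strict (pair₂ V K) = strict-≡
    (λ Q → trans (cong (_ †ˢ) (𝒮-value V)) (†ˢ-identityˡ _ ⟦ V ⟧val)) (strict-† _ (evalContext-strict K))
  evalContext-strict (fst K)     = strict-† _ (evalContext-strict K)
  evalContext-strict (snd K)     = strict-† _ (evalContext-strict K)
  evalContext-strict (app₁ K N)  = strict-† _ (evalContext-strict K)
  evalContext-strict (app₂ M K)  = strict-≡
    (λ Q → †ˢ-identityˡ _ (λ a → 𝒮⟦ M ⟧ (a ∷ []))) (strict-† _ (evalContext-strict K))

  argsEvalContext-strict (here K Ms) = strict-† _ (evalContext-strict K)
  argsEvalContext-strict (there c A) = strict-≡
    (λ Q → †ˢ-identityˡ _ ⟦ c ⟧con) (strict-† _ (argsEvalContext-strict A))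

  ℰ⟦_⟧ : EffVal σ → S̲ 𝒮⟦ σ ⟧ᵗ
  ℰ⟦ value V ⟧    = ηˢ ⟦ V ⟧val
  ℰ⟦ E or F ⟧     = ℰ⟦ E ⟧ orˢ ℰ⟦ F ⟧
  ℰ⟦ c · E ⟧      = ⟦ c ⟧con ·ˢ ℰ⟦ E ⟧
  ℰ⟦ E +[ p ] F ⟧ = ℰ⟦ E ⟧ +ˢ[ p ] ℰ⟦ F ⟧

  -- Strictness turns an evaluation context into a Kleisli extension. Reductions act inside it, and
  -- the effect rules hold because `orˢ`, `·ˢ` and `+ˢ` commute with it.
  soundness : {M : Program σ} {E : EffVal σ} → M ⇓ E → 𝒮⟦ M ⟧ [] ≡ ℰ⟦ E ⟧
  soundness (⇓val V) = 𝒮-value V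
  soundness (⇓step (inside K {Q} {Q′} r) d) with evalContext-strict K
  ... | k , k-eq = begin
    𝒮⟦ K ⟪ Q ⟫ ⟧ []     ≡⟨ k-eq Q ⟩
    (k †ˢ) (𝒮⟦ Q ⟧ [])  ≡⟨ cong (k †ˢ) (𝒮-reduction r) ⟩
    (k †ˢ) (𝒮⟦ Q′ ⟧ []) ≡⟨ k-eq Q′ ⟨
    𝒮⟦ K ⟪ Q′ ⟫ ⟧ []    ≡⟨ soundness d ⟩
    _ ∎
  soundness (⇓or K {M₁} {M₂} d₁ d₂) with evalContext-strict K
  ... | k , k-eq = trans (k-eq (M₁ or M₂)) (trans (†ˢ-or k (𝒮⟦ M₁ ⟧ []) (𝒮⟦ M₂ ⟧ [])) (cong₂ _orˢ_
    (trans (sym (k-eq M₁)) (soundness d₁)) (trans (sym (k-eq M₂)) (soundness d₂))))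
  soundness (⇓mix K {p} {M₁} {M₂} d₁ d₂) with evalContext-strict K
  ... | k , k-eq = trans (k-eq (M₁ +[ p ] M₂)) (trans (†ˢ-mix k p (𝒮⟦ M₁ ⟧ []) (𝒮⟦ M₂ ⟧ [])) (cong₂ _+ˢ[ p ]_
    (trans (sym (k-eq M₁)) (soundness d₁)) (trans (sym (k-eq M₂)) (soundness d₂))))
  soundness (⇓act K {c} {M} d) with evalContext-strict K
  ... | k , k-eq = trans (k-eq (con c · M)) (trans (cong (k †ˢ) (†ˢ-identityˡ (_·ˢ 𝒮⟦ M ⟧ []) ⟦ c ⟧con))
    (trans (†ˢ-· k ⟦ c ⟧con (𝒮⟦ M ⟧ [])) (cong (⟦ c ⟧con ·ˢ_) (trans (sym (k-eq M)) (soundness d)))))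

  𝒮-Op : (M : Program σ) → 𝒮⟦ M ⟧ [] ≡ ℰ⟦ Op M ⟧
  𝒮-Op M = soundness (⇓-Op M)

  -- Optimal strategies

  SameOrder : (f g : X → R) → Set
  SameOrder f g = ∀ s t → f s R.≤ f t ⇔ g s R.≤ g t

  opt : (E : EffVal σ) → (Str E → R) → Str E
  opt E f = proj₁ (leastMaximizer E f)

  -- The case split inside `leastMaximizer` is recast as a boolean conditional, which can be
  -- rewritten and moved through functions.
  opt-or : (E F : EffVal σ) (f : Str (E or F) → R) →
           opt (E or F) f ≡ (if ⌊ em {f (inj₂ (opt F (f ∘ inj₂))) R.≤ f (inj₁ (opt E (f ∘ inj₁)))} ⌋
                             then inj₁ (opt E (f ∘ inj₁)) else inj₂ (opt F (f ∘ inj₂)))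
  opt-or E F f with em {f (inj₂ (opt F (f ∘ inj₂))) R.≤ f (inj₁ (opt E (f ∘ inj₁)))}
  ... | yes _ = refl
  ... | no  _ = refl

  em-⇔ : {P Q : Set} → P ⇔ Q → ⌊ em {P} ⌋ ≡ ⌊ em {Q} ⌋
  em-⇔ {P} {Q} P⇔Q with em {P} | em {Q}
  ... | yes _ | yes _ = refl
  ... | no _  | no _  = refl
  ... | yes p | no ¬q = contradiction (Equivalence.to P⇔Q p) ¬q
  ... | no ¬p | yes q = contradiction (Equivalence.from P⇔Q q) ¬p

  -- The search for a least maximizer uses the objective only through comparisons of its values.
  opt-cong : (E : EffVal σ) (f g : Str E → R) → SameOrder f g → opt E f ≡ opt E g
  opt-cong (value V) f g f~g = refl
  opt-cong (E or F) f g f~g = begin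
    opt (E or F) f ≡⟨ opt-or E F f ⟩
    choose f (opt E (f ∘ inj₁)) (opt F (f ∘ inj₂))
      ≡⟨ cong₂ (choose f) (opt-cong E _ _ λ s t → f~g (inj₁ s) (inj₁ t)) (opt-cong F _ _ λ s t → f~g (inj₂ s) (inj₂ t)) ⟩
    choose f s t
      ≡⟨ cong (λ b → if b then inj₁ s else inj₂ t) (em-⇔ (f~g (inj₂ t) (inj₁ s))) ⟩
    choose g s t ≡⟨ opt-or E F g ⟨
    opt (E or F) g ∎
    where
    s : Str E
    s = opt E (g ∘ inj₁)
    t : Str F
    t = opt F (g ∘ inj₂)
    choose : (Str (E or F) → R) → Str E → Str F → Str (E or F)
    choose h u v = if ⌊ em {h (inj₂ v) R.≤ h (inj₁ u)} ⌋ then inj₁ u else inj₂ v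
  opt-cong (c · E) f g f~g = opt-cong E f g f~g
  opt-cong (E +[ p ] F) f g f~g = cong₂ _,_ s≡ (trans (t≡ _) (cong (t g) s≡))
    where
    t : (Str (E +[ p ] F) → R) → Str E → Str F
    t h u = opt F (λ v → h (u , v))
    t≡ : ∀ u → t f u ≡ t g u
    t≡ u = opt-cong F _ _ λ v w → f~g (u , v) (u , w)
    s≡ : opt E (λ u → f (u , t f u)) ≡ opt E (λ u → g (u , t g u))
    -- The best replies are first changed from those for `f` to those for `g` while the objective
    -- remains `f`; only then is the objective exchanged.
    s≡ = trans (cong (λ h → opt E (λ u → f (u , h u))) (ext t≡))
               (opt-cong E _ _ λ u v → f~g (u , t g u) (v , t g v))

  sameOrder-≗ : {f g : X → R} → (∀ s → f s ≡ g s) → SameOrder f g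
  sameOrder-≗ f≗g s t = mk⇔ (subst₂ R._≤_ (f≗g s) (f≗g t)) (subst₂ R._≤_ (sym (f≗g s)) (sym (f≗g t)))

  sameOrder-trans : {f g h : X → R} → SameOrder f g → SameOrder g h → SameOrder f h
  sameOrder-trans f~g g~h s t = mk⇔
    (Equivalence.to (g~h s t) ∘ Equivalence.to (f~g s t))
    (Equivalence.from (f~g s t) ∘ Equivalence.from (g~h s t))

  sameOrder-+ : ∀ r (f : X → R) → SameOrder (λ s → r R.+ f s) f
  sameOrder-+ r f = sameOrder-trans (sameOrder-≗ λ s → IsCommutativeMonoid.comm R.isCommutativeMonoid r (f s))
    λ s t → let r≤s⇔ = R.+-≤ (f s) (f t) r in mk⇔ (Equivalence.from r≤s⇔) (Equivalence.to r≤s⇔)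

  sameOrder-mixˡ : ∀ p → 0< p → p <1 → (f : X → R) → ∀ r → SameOrder (λ s → f s R.+[ p ] r) f
  sameOrder-mixˡ p 0<p p<1 f r s t =
    let r≤s⇔ = R.mix-≤ p 0<p p<1 (f s) (f t) r in mk⇔ (Equivalence.from r≤s⇔) (Equivalence.to r≤s⇔)

  sameOrder-mixʳ : ∀ p → 0< (1- p) → (1- p) <1 → (f : X → R) → ∀ r → SameOrder (λ s → r R.+[ p ] f s) f
  sameOrder-mixʳ p 0<1-p 1-p<1 f r = sameOrder-trans
    (sameOrder-≗ λ s → IsBarycentricAlgebra.skew R.isBarycentricAlgebra p r (f s))
    (sameOrder-mixˡ (1- p) 0<1-p 1-p<1 f r)

  -- Outcome distributions as elements of `T`, and their expected rewards.

  act-η : R × X → T X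
  act-η (r , x) = r T.· T.η x

  θ-dirac : (x : X) → θ (dirac (R.0# , x)) ≡ T.η x
  θ-dirac x = trans (convex-dirac TM.isBarycentricAlgebra (act-η (R.0# , x))) (TM.·-identity (T.η x))

  θ-· : ∀ r (D : DW X) → θ (r ·ᴰ D) ≡ r T.· θ D
  θ-· r D = begin
    convex em T._+[_]_ (mapDist act-η (r ·ᴰ D))
      ≡⟨ cong (convex em T._+[_]_) (mapDist-∘ act-η (map₁ (r R.+_)) D) ⟩
    convex em T._+[_]_ (mapDist (act-η ∘ map₁ (r R.+_)) D)
      ≡⟨ cong (convex em T._+[_]_) (mapDist-cong (λ { (s , x) → TM.·-assoc r s (T.η x) }) D) ⟨
    convex em T._+[_]_ (mapDist ((r T.·_) ∘ act-η) D)
      ≡⟨ cong (convex em T._+[_]_) (mapDist-∘ (r T.·_) act-η D) ⟨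
    convex em T._+[_]_ (mapDist (r T.·_) (mapDist act-η D))
      ≡⟨ convex-map (r T.·_) (λ p → TM.·-distribˡ-mix p r) (mapDist act-η D) ⟨
    r T.· θ D ∎

  θ-mix : ∀ p (D E : DW X) → θ (mixDist p D E) ≡ (θ D T.+[ p ] θ E)
  θ-mix p D E = trans (cong (convex em T._+[_]_) (mapDist-mix act-η p D E))
                      (convex-mix TM.isBarycentricAlgebra p (mapDist act-η D) (mapDist act-η E))

  -- By definition 𝐑 F zeroReward is ε (F zeroReward).
  ε : T X → R
  ε u = T.α (T.map (λ _ → R.0#) u)

  ε-η : (x : X) → ε (T.η x) ≡ R.0#
  ε-η x = trans (cong T.α (T.†-identityˡ _ x)) (T.α-η R.0#)

  ε-· : ∀ r (u : T X) → ε (r T.· u) ≡ r R.+ ε u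
  ε-· r u = trans (cong T.α (T.·-algebraic _ r u)) (T.α-· r _)

  ε-mix : ∀ p (u v : T X) → ε (u T.+[ p ] v) ≡ (ε u R.+[ p ] ε v)
  ε-mix p u v = trans (cong T.α (T.mix-algebraic _ p u v)) (T.α-mix p _ _)

  ε-·η : ∀ r (x : X) → ε (r T.· T.η x) ≡ r
  ε-·η r x = trans (ε-· r (T.η x))
    (trans (cong (r R.+_) (ε-η x)) (IsCommutativeMonoid.identityʳ R.isCommutativeMonoid r))

  ε-map : (f : X → Y) (u : T X) → ε (T.map f u) ≡ ε u
  ε-map f u = cong T.α (†-∘-map (λ _ → T.η R.0#) f u)

  -- `ε` preserves `+[ p ]` and sends r · η(x) to r. Hence the reward that the semantics compares is
  -- the expected reward that the strategies maximize.
  ε-θ : (D : DW X) → ε (θ D) ≡ 𝐄 D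
  ε-θ D = begin
    ε (convex em T._+[_]_ (mapDist act-η D))         ≡⟨ convex-map ε ε-mix (mapDist act-η D) ⟩
    convex em R._+[_]_ (mapDist ε (mapDist act-η D)) ≡⟨ cong (convex em R._+[_]_) (mapDist-∘ ε act-η D) ⟩
    convex em R._+[_]_ (mapDist (ε ∘ act-η) D)
      ≡⟨ cong (convex em R._+[_]_) (mapDist-cong (λ { (r , x) → ε-·η r x }) D) ⟩
    𝐄 D ∎

  -- Both `θ` and `ε` respect the action, and `𝐄` is their composite; `𝐄-mix` follows in the same
  -- way.
  𝐄-· : ∀ r (D : DW X) → 𝐄 (r ·ᴰ D) ≡ r R.+ 𝐄 D
  𝐄-· r D = begin
    𝐄 (r ·ᴰ D)      ≡⟨ ε-θ (r ·ᴰ D) ⟨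
    ε (θ (r ·ᴰ D))  ≡⟨ cong ε (θ-· r D) ⟩
    ε (r T.· θ D)   ≡⟨ ε-· r (θ D) ⟩
    r R.+ ε (θ D)   ≡⟨ cong (r R.+_) (ε-θ D) ⟩
    r R.+ 𝐄 D       ∎

  𝐄-mix : ∀ p (D E : DW X) → 𝐄 (mixDist p D E) ≡ (𝐄 D R.+[ p ] 𝐄 E)
  𝐄-mix p D E = begin
    𝐄 (mixDist p D E)              ≡⟨ ε-θ (mixDist p D E) ⟨
    ε (θ (mixDist p D E))          ≡⟨ cong ε (θ-mix p D E) ⟩
    ε (θ D T.+[ p ] θ E)           ≡⟨ ε-mix p (θ D) (θ E) ⟩
    (ε (θ D) R.+[ p ] ε (θ E))     ≡⟨ cong₂ R._+[ p ]_ (ε-θ D) (ε-θ E) ⟩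
    (𝐄 D R.+[ p ] 𝐄 E)             ∎

  -- Ob M is observed (Op M) by definition.
  observed : EffVal σ → T (Val σ)
  observed E = θ (Out E (opt E (Rew E)))

  observed-or : (E F : EffVal σ) →
                observed (E or F) ≡ (if ⌊ em {Rew F (opt F (Rew F)) R.≤ Rew E (opt E (Rew E))} ⌋
                                     then observed E else observed F)
  observed-or E F = trans (cong (θ ∘ Out (E or F)) (opt-or E F (Rew (E or F))))
                          (if-float (θ ∘ Out (E or F)) ⌊ em ⌋)

  -- Adding ⟦c⟧ to every reward preserves and reflects the order, so the optimal strategy of `E` is
  -- unchanged.
  observed-· : ∀ c (E : EffVal σ) → observed (c · E) ≡ ⟦ c ⟧con T.· observed E
  observed-· c E = trans (cong (θ ∘ Out (c · E)) (opt-cong E _ _ same)) (θ-· ⟦ c ⟧con (Out E (opt E (Rew E))))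
    where
    same : SameOrder (Rew (c · E)) (Rew E)
    same = sameOrder-trans (sameOrder-≗ λ s → 𝐄-· ⟦ c ⟧con (Out E s)) (sameOrder-+ ⟦ c ⟧con (Rew E))

  -- For 0 < p < 1 mixing is strictly monotone in each argument, so the lexicographically least
  -- optimum consists of the two separate optima. For p = 0 or p = 1 one component of the chosen
  -- pair may be far from optimal, but the mixture discards its outcome.
  observed-mix : ∀ p (E F : EffVal σ) → observed (E +[ p ] F) ≡ (observed E T.+[ p ] observed F)
  observed-mix p E F = trans (θ-mix p (Out E s) (Out F (t s))) (cases em em)
    where
    f : Str E × Str F → R
    f = Rew (E +[ p ] F)
    t : Str E → Str F
    t u = opt F (λ v → f (u , v))
    s : Str E
    s = opt E (λ u → f (u , t u))
    f-mix : ∀ u v → f (u , v) ≡ (Rew E u R.+[ p ] Rew F v)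
    f-mix u v = 𝐄-mix p (Out E u) (Out F v)
    Goal : Set
    Goal = (θ (Out E s) T.+[ p ] θ (Out F (t s))) ≡ (observed E T.+[ p ] observed F)
    cases : Dec (I.value p ≡ ℝ.0#) → Dec (I.value p ≡ ℝ.1#) → Goal
    cases (yes p≡0) _ = begin
      (θ (Out E s) T.+[ p ] θ (Out F (t s))) ≡⟨ mix-≡0 TM.isBarycentricAlgebra p _ _ p≡0 ⟩
      θ (Out F (t s))                        ≡⟨ cong (θ ∘ Out F) (opt-cong F _ _ same) ⟩
      observed F                             ≡⟨ mix-≡0 TM.isBarycentricAlgebra p _ _ p≡0 ⟨
      (observed E T.+[ p ] observed F)       ∎
      where
      same : SameOrder (λ v → f (s , v)) (Rew F)
      same = sameOrder-≗ λ v → trans (f-mix s v) (mix-≡0 R.isBarycentricAlgebra p _ _ p≡0)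
    cases _ (yes p≡1) = begin
      (θ (Out E s) T.+[ p ] θ (Out F (t s))) ≡⟨ mix-≡1 TM.isBarycentricAlgebra p _ _ p≡1 ⟩
      θ (Out E s)                            ≡⟨ cong (θ ∘ Out E) (opt-cong E _ _ same) ⟩
      observed E                             ≡⟨ mix-≡1 TM.isBarycentricAlgebra p _ _ p≡1 ⟨
      (observed E T.+[ p ] observed F)       ∎
      where
      same : SameOrder (λ u → f (u , t u)) (Rew E)
      same = sameOrder-≗ λ u → trans (f-mix u (t u)) (mix-≡1 R.isBarycentricAlgebra p _ _ p≡1)
    cases (no p≢0) (no p≢1) =
      cong₂ (λ u v → θ (Out E u) T.+[ p ] θ (Out F v)) (opt-cong E _ _ same) (t≡ s)
      where
      0<p : 0< p
      0<p = 0≤value p , p≢0 ∘ sym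
      p<1 : p <1
      p<1 = value≤1 p , p≢1
      -- The best reply in `F` does not depend on the strategy `u` chosen in `E`.
      t≡ : ∀ u → t u ≡ opt F (Rew F)
      t≡ u = opt-cong F _ _ (sameOrder-trans (sameOrder-≗ (f-mix u))
               (sameOrder-mixʳ p (0<1- {p} p<1) (1-<1 {p} 0<p) (Rew F) (Rew E u)))
      same : SameOrder (λ u → f (u , t u)) (Rew E)
      same = sameOrder-trans
        (sameOrder-≗ λ u → trans (f-mix u (t u)) (cong (λ v → Rew E u R.+[ p ] Rew F v) (t≡ u)))
        (sameOrder-mixˡ p 0<p p<1 (Rew E) (Rew F (opt F (Rew F))))

  -- Adequacy at the zero reward continuation.

  zeroReward : X → R
  zeroReward _ = R.0#

  adequacyᴱ : (E : EffVal σ) → ℰ⟦ E ⟧ zeroReward ≡ T.map ⟦_⟧val (observed E)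
  adequacyᴱ (value V) = sym (trans (cong (T.map ⟦_⟧val) (θ-dirac V)) (T.†-identityˡ _ V))
  adequacyᴱ (E or F) = begin
    (ℰ⟦ E ⟧ orˢ ℰ⟦ F ⟧) zeroReward
      ≡⟨ cong₂ (λ r s → if ⌊ em {r R.≤ s} ⌋ then ℰ⟦ E ⟧ zeroReward else ℰ⟦ F ⟧ zeroReward) (reward F) (reward E) ⟩
    (if left? then ℰ⟦ E ⟧ zeroReward else ℰ⟦ F ⟧ zeroReward)
      ≡⟨ cong₂ (if left? then_else_) (adequacyᴱ E) (adequacyᴱ F) ⟩
    (if left? then T.map ⟦_⟧val (observed E) else T.map ⟦_⟧val (observed F))
      ≡⟨ if-float (T.map ⟦_⟧val) left? ⟨
    T.map ⟦_⟧val (if left? then observed E else observed F)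
      ≡⟨ cong (T.map ⟦_⟧val) (observed-or E F) ⟨
    T.map ⟦_⟧val (observed (E or F)) ∎
    where
    left? : Bool
    left? = ⌊ em {Rew F (opt F (Rew F)) R.≤ Rew E (opt E (Rew E))} ⌋
    -- By the induction hypothesis, the quantity compared by `orˢ` is the expected reward of the
    -- optimal strategy of `G`, which is what `opt-or` compares. Ties favour the left in both.
    reward : (G : EffVal _) → 𝐑 ℰ⟦ G ⟧ zeroReward ≡ Rew G (opt G (Rew G))
    reward G = trans (cong ε (adequacyᴱ G)) (trans (ε-map ⟦_⟧val (observed G)) (ε-θ (Out G (opt G (Rew G)))))
  adequacyᴱ (c · E) = begin
    ⟦ c ⟧con T.· ℰ⟦ E ⟧ zeroReward              ≡⟨ cong (⟦ c ⟧con T.·_) (adequacyᴱ E) ⟩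
    ⟦ c ⟧con T.· T.map ⟦_⟧val (observed E)      ≡⟨ T.·-algebraic _ ⟦ c ⟧con (observed E) ⟨
    T.map ⟦_⟧val (⟦ c ⟧con T.· observed E)      ≡⟨ cong (T.map ⟦_⟧val) (observed-· c E) ⟨
    T.map ⟦_⟧val (observed (c · E))             ∎
  adequacyᴱ (E +[ p ] F) = begin
    (ℰ⟦ E ⟧ zeroReward T.+[ p ] ℰ⟦ F ⟧ zeroReward)
      ≡⟨ cong₂ T._+[ p ]_ (adequacyᴱ E) (adequacyᴱ F) ⟩
    (T.map ⟦_⟧val (observed E) T.+[ p ] T.map ⟦_⟧val (observed F))
      ≡⟨ T.mix-algebraic _ p (observed E) (observed F) ⟨
    T.map ⟦_⟧val (observed E T.+[ p ] observed F)
      ≡⟨ cong (T.map ⟦_⟧val) (observed-mix p E F) ⟨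
    T.map ⟦_⟧val (observed (E +[ p ] F)) ∎

  adequacy : (M : Program (base bool)) → 𝒮⟦ M ⟧ [] zeroReward ≡ T.map ⟦_⟧val (Ob M)
  adequacy M = trans (cong (λ F → F zeroReward) (𝒮-Op M)) (adequacyᴱ (Op M))

  -- Separating contexts

  -- Kleisli extension passes through every operation down to the leaves, so two continuations need
  -- to agree only on the finitely many values found there.
  †ˢ-leaves : (h k : 𝒮⟦ σ ⟧ᵗ → S̲ X) (E : EffVal σ) →
              AllLeaves (λ V → h ⟦ V ⟧val ≡ k ⟦ V ⟧val) E → (h †ˢ) ℰ⟦ E ⟧ ≡ (k †ˢ) ℰ⟦ E ⟧
  †ˢ-leaves h k (value V) h≡k =
    trans (†ˢ-identityˡ h ⟦ V ⟧val) (trans h≡k (sym (†ˢ-identityˡ k ⟦ V ⟧val)))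
  †ˢ-leaves h k (E or F) (e , f) = begin
    (h †ˢ) (ℰ⟦ E ⟧ orˢ ℰ⟦ F ⟧)           ≡⟨ †ˢ-or h ℰ⟦ E ⟧ ℰ⟦ F ⟧ ⟩
    (h †ˢ) ℰ⟦ E ⟧ orˢ (h †ˢ) ℰ⟦ F ⟧      ≡⟨ cong₂ _orˢ_ (†ˢ-leaves h k E e) (†ˢ-leaves h k F f) ⟩
    (k †ˢ) ℰ⟦ E ⟧ orˢ (k †ˢ) ℰ⟦ F ⟧      ≡⟨ †ˢ-or k ℰ⟦ E ⟧ ℰ⟦ F ⟧ ⟨
    (k †ˢ) (ℰ⟦ E ⟧ orˢ ℰ⟦ F ⟧)           ∎
  †ˢ-leaves h k (c · E) e = begin
    (h †ˢ) (⟦ c ⟧con ·ˢ ℰ⟦ E ⟧)          ≡⟨ †ˢ-· h ⟦ c ⟧con ℰ⟦ E ⟧ ⟩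
    ⟦ c ⟧con ·ˢ (h †ˢ) ℰ⟦ E ⟧            ≡⟨ cong (⟦ c ⟧con ·ˢ_) (†ˢ-leaves h k E e) ⟩
    ⟦ c ⟧con ·ˢ (k †ˢ) ℰ⟦ E ⟧            ≡⟨ †ˢ-· k ⟦ c ⟧con ℰ⟦ E ⟧ ⟨
    (k †ˢ) (⟦ c ⟧con ·ˢ ℰ⟦ E ⟧)          ∎
  †ˢ-leaves h k (E +[ p ] F) (e , f) = begin
    (h †ˢ) (ℰ⟦ E ⟧ +ˢ[ p ] ℰ⟦ F ⟧)             ≡⟨ †ˢ-mix h p ℰ⟦ E ⟧ ℰ⟦ F ⟧ ⟩
    ((h †ˢ) ℰ⟦ E ⟧ +ˢ[ p ] (h †ˢ) ℰ⟦ F ⟧)      ≡⟨ cong₂ _+ˢ[ p ]_ (†ˢ-leaves h k E e) (†ˢ-leaves h k F f) ⟩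
    ((k †ˢ) ℰ⟦ E ⟧ +ˢ[ p ] (k †ˢ) ℰ⟦ F ⟧)      ≡⟨ †ˢ-mix k p ℰ⟦ E ⟧ ℰ⟦ F ⟧ ⟨
    (k †ˢ) (ℰ⟦ E ⟧ +ˢ[ p ] ℰ⟦ F ⟧)             ∎

  constants : EffVal (base b) → List (Con b)
  constants (value (con c)) = c ∷ []
  constants (E or F)        = constants E ++ constants F
  constants (c · E)         = constants E
  constants (E +[ p ] F)    = constants E ++ constants F

  allLeaves : {P : Val (base b) → Set} (E : EffVal (base b)) →
              (∀ {c} → c ∈ constants E → P (con c)) → AllLeaves P E
  allLeaves (value (con c)) h = h (here refl)
  allLeaves (E or F)        h = allLeaves E (h ∘ ∈-++⁺ˡ) , allLeaves F (h ∘ ∈-++⁺ʳ (constants E))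
  allLeaves (c · E)         h = allLeaves E h
  allLeaves (E +[ p ] F)    h = allLeaves E (h ∘ ∈-++⁺ˡ) , allLeaves F (h ∘ ∈-++⁺ʳ (constants E))

  -- The ideal continuation γ(x) · f(x), which need not be the denotation of any term.
  test : (X → R) → (X → Bool) → X → S̲ Bool
  test γ f x = γ x ·ˢ ηˢ (f x)

  -- At the zero continuation the reward of γ(x) · f(x) is γ(x), so `F` is evaluated at `γ`. What
  -- follows adds γ(x) to the reward and relabels by `f`.
  test-† : (γ : X → R) (f : X → Bool) (F : S̲ X) →
           (test γ f †ˢ) F zeroReward ≡ T.map f (rewardAdd γ (F γ))
  test-† γ f F = begin
    ((λ x → γ x T.· T.η (f x)) T.†) (F (λ x → ε (γ x T.· T.η (f x))))
      ≡⟨ cong (((λ x → γ x T.· T.η (f x)) T.†) ∘ F) (ext λ x → ε-·η (γ x) (f x)) ⟩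
    ((λ x → γ x T.· T.η (f x)) T.†) (F γ)
      ≡⟨ †-cong (λ x → trans (T.·-algebraic _ (γ x) (T.η x)) (cong (γ x T.·_) (T.†-identityˡ _ x))) (F γ) ⟨
    ((λ x → T.map f (γ x T.· T.η x)) T.†) (F γ)
      ≡⟨ map-∘-† f (λ x → γ x T.· T.η x) (F γ) ⟨
    T.map f (rewardAdd γ (F γ)) ∎

  boolᶜ : Bool → Con bool
  boolᶜ t = if t then ttᶜ else ffᶜ

  ⟦boolᶜ⟧ : ∀ t → ⟦ boolᶜ t ⟧con ≡ t
  ⟦boolᶜ⟧ true  = ⟦tt⟧
  ⟦boolᶜ⟧ false = ⟦ff⟧

  module _ (numerable : Numerable) {b : Base} (γ : ⟦ b ⟧base → R) (f : ⟦ b ⟧base → Bool) where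

    rewᶜ : R → Con rew
    rewᶜ r = proj₁ (numerable r)

    branch : Con b → Term (base b ∷ []) (base bool)
    branch c = con (rewᶜ (γ ⟦ c ⟧con)) · con (boolᶜ (f ⟦ c ⟧con))

    tester : List (Con b) → Term (base b ∷ []) (base bool)
    -- An arbitrary default: it is reached only by inputs that differ from all listed constants,
    -- which `𝒮-tester` excludes.
    tester []       = con ttᶜ
    tester (c ∷ cs) = if (fun (eq b) (var Z ∷ con c ∷ [])) (branch c) (tester cs)

    𝒮-branch : ∀ c {ρ} → 𝒮⟦ branch c ⟧ ρ ≡ test γ f ⟦ c ⟧con
    𝒮-branch c = trans (†ˢ-identityˡ _ ⟦ rewᶜ (γ ⟦ c ⟧con) ⟧con)
      (cong₂ (λ r t → r ·ˢ ηˢ t) (proj₂ (numerable (γ ⟦ c ⟧con))) (⟦boolᶜ⟧ (f ⟦ c ⟧con)))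

    𝒮-tester : ∀ {c cs} → c ∈ cs → 𝒮⟦ tester cs ⟧ (⟦ c ⟧con ∷ []) ≡ test γ f ⟦ c ⟧con
    𝒮-tester {c} {d ∷ cs} c∈ = trans (trans
      -- With ⟦c⟧ in the environment, the open condition has by definition the denotation of the
      -- closed redex that compares `c` with `d`, so the reduction rule for `eq` evaluates it.
      (cong (_ †ˢ) (𝒮-reduction (fun (eq b) (c ∷ d ∷ []))))
      (†ˢ-identityˡ (λ t → if t then 𝒮⟦ branch d ⟧ ρ else 𝒮⟦ tester cs ⟧ ρ) ⟦ val (eq b) (c ∷ d ∷ []) ⟧con))
      (select c∈ em)
      where
      ρ : 𝒮⟦ base b ∷ [] ⟧ᶜ
      ρ = ⟦ c ⟧con ∷ []
      select : c ∈ d ∷ cs → Dec (c ≡ d) →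
               (if ⟦ val (eq b) (c ∷ d ∷ []) ⟧con then 𝒮⟦ branch d ⟧ ρ else 𝒮⟦ tester cs ⟧ ρ) ≡ test γ f ⟦ c ⟧con
      select _ (yes refl) = trans
        (cong (if_then 𝒮⟦ branch d ⟧ ρ else 𝒮⟦ tester cs ⟧ ρ) (trans (cong ⟦_⟧con (val-eq-≡ c)) ⟦tt⟧))
        (𝒮-branch c {ρ})
      select (here c≡d)  (no c≢d) = contradiction c≡d c≢d
      select (there c∈cs) (no c≢d) = trans
        (cong (if_then 𝒮⟦ branch d ⟧ ρ else 𝒮⟦ tester cs ⟧ ρ) (trans (cong ⟦_⟧con (val-eq-≢ c d c≢d)) ⟦ff⟧))
        (𝒮-tester c∈cs)

    -- An applied abstraction serves as `let`: the program in the hole is evaluated once and its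
    -- value is passed to `tester`.
    testContext : List (Con b) → Context (base b) [] (base bool)
    testContext cs = app₂ (ƛ (tester cs)) □

    -- Adequacy moves the observation to the zero continuation, where `tester cs` may be replaced by
    -- the ideal test on the leaves of `M`. The list may be larger than needed for `M`, so that one
    -- context can serve two programs.
    Ob-testContext : (cs : List (Con b)) (M : Program (base b)) → (∀ {c} → c ∈ constants (Op M) → c ∈ cs) →
                     T.map ⟦_⟧val (Ob (fill (testContext cs) M)) ≡ T.map f (rewardAdd γ (𝒮⟦ M ⟧ [] γ))
    Ob-testContext cs M covers = begin
      T.map ⟦_⟧val (Ob (fill (testContext cs) M))     ≡⟨ adequacy (fill (testContext cs) M) ⟨
      𝒮⟦ fill (testContext cs) M ⟧ [] zeroReward      ≡⟨ cong (λ F → F zeroReward) (begin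
        𝒮⟦ fill (testContext cs) M ⟧ []                 ≡⟨ †ˢ-identityˡ _ h ⟩
        (h †ˢ) (𝒮⟦ weaken M ⟧ [])                       ≡⟨ cong (h †ˢ) (trans (𝒮-rename (λ ()) (λ ()) M) (𝒮-Op M)) ⟩
        (h †ˢ) ℰ⟦ Op M ⟧                                ≡⟨ †ˢ-leaves h (test γ f) (Op M) (allLeaves (Op M) (𝒮-tester ∘ covers)) ⟩
        (test γ f †ˢ) ℰ⟦ Op M ⟧                         ≡⟨ cong (test γ f †ˢ) (𝒮-Op M) ⟨
        (test γ f †ˢ) (𝒮⟦ M ⟧ [])                       ∎) ⟩
      (test γ f †ˢ) (𝒮⟦ M ⟧ []) zeroReward            ≡⟨ test-† γ f (𝒮⟦ M ⟧ []) ⟩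
      T.map f (rewardAdd γ (𝒮⟦ M ⟧ [] γ))             ∎
      where
      h : ⟦ b ⟧base → S̲ Bool
      h a = 𝒮⟦ tester cs ⟧ (a ∷ [])

  fullAbstraction : BoolCharacteristic → RewardAdditionInjective → Numerable →
                    (b : Base) (M N : Program (base b)) → M ≈ N → 𝒮⟦ M ⟧ ≡ 𝒮⟦ N ⟧
  fullAbstraction characteristic injective numerable b M N M≈N =
    -- The characteristic property yields `f` only from an inequality, so equality at each `γ` is
    -- shown by refuting its negation.
    ext λ { [] → ext λ γ → decidable-stable em λ Mγ≢Nγ →
      -- Injectivity of reward addition keeps the two elements distinct after k_γ is applied, and
      -- `f` separates these images.
      let (f , separated) = characteristic _ _ (Mγ≢Nγ ∘ injective γ)
          cs = constants (Op M) ++ constants (Op N)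
      in separated (begin
        T.map f (rewardAdd γ (𝒮⟦ M ⟧ [] γ))
          ≡⟨ Ob-testContext numerable γ f cs M ∈-++⁺ˡ ⟨
        T.map ⟦_⟧val (Ob (fill (testContext numerable γ f cs) M))
          ≡⟨ cong (T.map ⟦_⟧val) (M≈N (testContext numerable γ f cs)) ⟩
        T.map ⟦_⟧val (Ob (fill (testContext numerable γ f cs) N))
          ≡⟨ Ob-testContext numerable γ f cs N (∈-++⁺ʳ (constants (Op M))) ⟩
        T.map f (rewardAdd γ (𝒮⟦ N ⟧ [] γ)) ∎) }

theorem5p14 :
    (em : ExcludedMiddle 0ℓ) → Extensionality 0ℓ 0ℓ →
    (ℝ : CompleteOrderedField) →
    let open Structures ℝ in
    (𝓡 : RewardAlgebra) (Sg : Signature) (𝓘 : Interpretation 𝓡 Sg) (𝓣 : AuxiliaryMonad 𝓡) →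
    let open Signature Sg using (Base)
        open Syntax ℝ Sg using (Program)
        open Semantics em ℝ 𝓡 Sg 𝓘 𝓣 in
    BoolCharacteristic → RewardAdditionInjective → Numerable →
    (b : Base) (M N : Program (base b)) → M ≈ N → 𝒮⟦ M ⟧ ≡ 𝒮⟦ N ⟧
theorem5p14 em ext ℝ 𝓡 Sg 𝓘 𝓣 = FullAbstraction.fullAbstraction em ext ℝ 𝓡 Sg 𝓘 𝓣
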